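{- Some properties of distributions on $[n]$ require $\Omega(n)$ conditional samples to test (adaptively or not). That is, there exist constants $\epsilon>0$, $c>0$ and, for every $n$, a set $\mathcal P_n$ of distributions over $[n]$, such that for all sufficiently large $n$ every (adaptive or non-adaptive) distribution tester for $\mathcal P_n$, with distance parameter $\epsilon$ and error bound $\delta=\frac13$, must use at least $cn$ conditional samples.
   Context: $[n]=\{1,\ldots,n\}$; the variation distance is $d(\mu,\mu')=\frac12\sum_{i=1}^n|\mu(i)-\mu'(i)|$. A property is a set of distributions over $[n]$ (not required to be invariant under permutations of $[n]$). $\mu$ is $\epsilon$-far from $\mathcal P$ if $d(\mu,\mu')\ge\epsilon$ for every $\mu'\in\mathcal P$. A conditional sampling oracle for $\mu$ takes a nonempty set $A\subseteq[n]$ and returns $j\in A$ with probability $\mu(j)/\mu(A)$ if $\mu(A)>0$, and a uniformly random member of $A$ if $\mu(A)=0$, independently of all previous samples. An adaptive distribution tester for $\mathcal P$ is a randomized algorithm that in each phase chooses a conditioning set based on the previously received samples and its internal coin tosses and receives the oracle's answer, and finally accepts or rejects; it must accept with probability at least $1-\delta$ if $\mu\in\mathcal P$ and reject with probability at least $1-\delta$ if $\mu$ is $\epsilon$-far from $\mathcal P$. A non-adaptive tester is one that fixes all conditioning sets before receiving any sample. -}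

module Defs where

open import Level using (_⊔_; suc)
open import Algebra.Bundles using (CommutativeRing)
open import Algebra.Core using (Op₁)
import Algebra.Construct.NaturalChoice.Max as Max
import Algebra.Definitions.RawMonoid as RawMonoidDefinitions
open import Data.Bool.Base using (Bool; true; false; if_then_else_; _xor_)
open import Data.Fin.Base using (Fin)
open import Data.Fin.Subset using (Subset; Nonempty; ∣_∣)
open import Data.List.Base using (List; []; _∷_; length)
open import Data.Nat.Base as ℕ using (ℕ)
open import Data.Product.Base using (∃; _×_; _,_)
open import Data.Vec.Base using (Vec; []; _∷_; lookup)
open import Data.Vec.Functional using (Vector; foldr)
open import Relation.Binary.Bundles using (DecTotalOrder)
open import Relation.Binary.Core using (Rel)
import Relation.Binary.Construct.NonStrictToStrict as NonStrictToStrict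
open import Relation.Binary.Definitions using (_Respects_)
open import Relation.Binary.Structures using (IsDecTotalOrder)
open import Relation.Nullary.Decidable.Core using (does)
open import Relation.Unary using (Pred)

-- Probabilities live in an arbitrary (discrete, totally) ordered field; the
-- classical real numbers are one instance.  Inversion is total, as is usual
-- for a total `_⁻¹`: nothing is assumed about the value of `0# ⁻¹`.
record OrderedField c ℓ₁ ℓ₂ : Set (suc (c ⊔ ℓ₁ ⊔ ℓ₂)) where
  infix 4 _≤_
  infix 8 _⁻¹
  field
    commutativeRing : CommutativeRing c ℓ₁
  open CommutativeRing commutativeRing public
  field
    _⁻¹             : Op₁ Carrier
    ⁻¹-cong         : ∀ {x y} → x ≈ y → x ⁻¹ ≈ y ⁻¹
    *-inverseʳ      : ∀ {x} → x ≉ 0# → x * x ⁻¹ ≈ 1#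
    1≉0             : 1# ≉ 0#
    _≤_             : Rel Carrier ℓ₂
    isDecTotalOrder : IsDecTotalOrder _≈_ _≤_
    +-monoʳ-≤       : ∀ z {x y} → x ≤ y → z + x ≤ z + y
    *-nonNegative   : ∀ {x y} → 0# ≤ x → 0# ≤ y → 0# ≤ x * y

  decTotalOrder : DecTotalOrder c ℓ₁ ℓ₂
  decTotalOrder = record { isDecTotalOrder = isDecTotalOrder }

  open IsDecTotalOrder isDecTotalOrder public
    using (_≟_; _≤?_)
  open NonStrictToStrict _≈_ _≤_ public using (_<_)
  open RawMonoidDefinitions +-rawMonoid public using (sum)

  abs : Op₁ Carrier
  abs x = x ⊔ᶠ (- x)
    where
    open Max (DecTotalOrder.totalOrder decTotalOrder) renaming (_⊔_ to _⊔ᶠ_)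

  fromℕ : ℕ → Carrier
  fromℕ n = n ×ᶠ 1#
    where
    open RawMonoidDefinitions +-rawMonoid renaming (_×_ to _×ᶠ_)

ConditioningSet : ℕ → Set
ConditioningSet n = ∃ λ (A : Subset n) → Nonempty A

module Testing {c ℓ₁ ℓ₂} (F : OrderedField c ℓ₁ ℓ₂) where

  open OrderedField F

  record Distribution (n : ℕ) : Set (c ⊔ ℓ₁ ⊔ ℓ₂) where
    field
      prob        : Vector Carrier n
      nonNegative : ∀ i → 0# ≤ prob i
      sum≈1       : sum prob ≈ 1#

  open Distribution public

  infix 4 _≈ᴰ_
  _≈ᴰ_ : ∀ {n} → Rel (Distribution n) ℓ₁
  μ ≈ᴰ ν = ∀ i → prob μ i ≈ prob ν i

  distance : ∀ {n} → Distribution n → Distribution n → Carrier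
  distance μ ν = fromℕ 2 ⁻¹ * sum (λ i → abs (prob μ i - prob ν i))

  record Property (n : ℕ) : Set (suc (c ⊔ ℓ₁ ⊔ ℓ₂)) where
    field
      Holds    : Pred (Distribution n) (c ⊔ ℓ₁ ⊔ ℓ₂)
      respects : Holds Respects _≈ᴰ_

  open Property public

  Far : ∀ {n} → Carrier → Distribution n → Property n → Set (c ⊔ ℓ₁ ⊔ ℓ₂)
  Far ε μ P = ∀ ν → Holds P ν → ε ≤ distance μ ν

  mass : ∀ {n} → Distribution n → Subset n → Carrier
  mass μ A = sum (λ i → if lookup A i then prob μ i else 0#)

  -- `oracle μ A j` is the probability that conditioning on `A` returns `j`.
  oracle : ∀ {n} → Distribution n → Subset n → Vector Carrier n
  oracle μ A j =
    if lookup A j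
    then (if does (mass μ A ≟ 0#)
          then fromℕ ∣ A ∣ ⁻¹
          else prob μ j * mass μ A ⁻¹)
    else 0#

  -- Randomised adaptive algorithms as decision trees: every phase may depend
  -- on all earlier coin tosses and samples.  The output `true` means accept.
  -- There are only finitely many deterministic trees of a given depth (up to
  -- unreachable branches), so coins with finitely many outcomes, but with
  -- arbitrary probabilities in the field, lose no generality.
  data Algorithm (n : ℕ) : Set (c ⊔ ℓ₁ ⊔ ℓ₂) where
    output : Bool → Algorithm n
    toss   : ∀ {k} → Distribution k → (Fin k → Algorithm n) → Algorithm n
    sample : ConditioningSet n → (Fin n → Algorithm n) → Algorithm n

  -- `Pr μ T b` is the probability that `T` outputs `b` when run on `μ`.
  Pr : ∀ {n} → Distribution n → Algorithm n → Bool → Carrier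
  Pr μ (output a)         b = if a xor b then 0# else 1#
  Pr μ (toss p T)         b = sum (λ r → prob p r * Pr μ (T r) b)
  Pr μ (sample (A , _) T) b = sum (λ j → oracle μ A j * Pr μ (T j) b)

  -- The worst-case number of samples; the oracle never answers outside the
  -- conditioning set, so those branches do not count.
  samples : ∀ {n} → Algorithm n → ℕ
  samples (output _)         = 0
  samples (toss _ T)         = foldr ℕ._⊔_ 0 (λ r → samples (T r))
  samples (sample (A , _) T) =
    ℕ.suc (foldr ℕ._⊔_ 0 (λ j → if lookup A j then samples (T j) else 0))

  -- All coins are tossed up front, including those that are used only for the
  -- final verdict.
  record NonAdaptive (n : ℕ) : Set (c ⊔ ℓ₁ ⊔ ℓ₂) where
    field
      {outcomes} : ℕ
      coins      : Distribution outcomes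
      queries    : Fin outcomes → List (ConditioningSet n)
      verdict    : ∀ r → Vec (Fin n) (length (queries r)) → Bool

  sampleAll : ∀ {n} (As : List (ConditioningSet n)) →
              (Vec (Fin n) (length As) → Bool) → Algorithm n
  sampleAll []       f = output (f [])
  sampleAll (A ∷ As) f = sample A (λ j → sampleAll As (λ js → f (j ∷ js)))

  algorithm : ∀ {n} → NonAdaptive n → Algorithm n
  algorithm T = toss coins (λ r → sampleAll (queries r) (verdict r))
    where open NonAdaptive T

  record IsTester {n} (P : Property n) (ε δ : Carrier) (T : Algorithm n)
                  : Set (c ⊔ ℓ₁ ⊔ ℓ₂) where
    field
      accepts : ∀ μ → Holds P μ → 1# - δ ≤ Pr μ T true
      rejects : ∀ μ → Far ε μ P → 1# - δ ≤ Pr μ T false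

{-# OPTIONS --safe #-}
module Submission where

-- The hard distributions.  A word x of m = n/2 bits gives each element of [n]
-- the weight 1 or 2: the i-th pair of elements has the weights 1, 2 or 2, 1
-- according to the i-th bit (a last odd element has weight 1).  All words give
-- the same total weight, so after normalization two words at Hamming distance
-- h give distributions whose distance is at least h / 2n.
--
-- One conditional sample is almost a function of few bits of x.  To sample
-- from A, draw j uniformly from A, accept it with probability weight j / 2,
-- and repeat after a rejection; every round looks at a single bit of x and
-- accepts with probability at least 1/2.  Run an algorithm T with q samples in
-- this way, and give up after fewer than e rounds (`approx`).  The probability
-- that the truncated run accepts is a polynomial in x of degree less than e
-- (`Degree<-approx`).  It never exceeds the acceptance probability of T
-- (`0≤error`), and it falls short by at most 2^q (3/4)^e (`error≤bound`),
-- which is at most 1/16 when e is at least 5 (q + 2).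
--
-- The hard property.  Put e = n/40, rounded down like m, and let V be the
-- number of words of length m and weight less than e.  Then V * V < 2^m
-- (`ballSize²<2^m`), so there is a code of V + 1 words of minimum distance e
-- (`separatedCode`, the Gilbert-Varshamov argument).  Polynomials of degree
-- less than e are spanned by V squarefree monomials, so there are coefficients
-- v on the codewords, not all zero, with the sum of v g equal to zero for every
-- such polynomial g (`dependent`, `annihilate`).  The property consists of the
-- distributions of the codewords with positive coefficient.  If e is positive,
-- those of the codewords with negative coefficient are far from it (`far`).
--
-- A tester with error 1/3 and 5 (q + 2) at most e would therefore yield a
-- polynomial g = approx - 1/2 of degree less than e that has the sign of v at
-- every codeword where v is not zero.  Then the sum of v g is positive, which
-- contradicts the choice of v (`no-tester`).  Hence q is linear in n.

open import Defs
open import Level using (_⊔_; Lift; lift)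
open import Algebra.Bundles using (RawRing)
import Algebra.Construct.NaturalChoice.Max as MaxProperties
import Algebra.Properties.Ring as RingProperties
import Algebra.Properties.Semiring.Mult as SemiringMult
import Algebra.Properties.Semiring.Sum as SemiringSum
import Algebra.Solver.Ring as RingSolver
open import Algebra.Solver.Ring.AlmostCommutativeRing using (fromCommutativeRing; _-Raw-AlmostCommutative⟶_)
open import Data.Bool.Base using (Bool; true; false; if_then_else_; not; _xor_)
open import Data.Fin.Base using (Fin; zero; suc; punchIn; _↑ˡ_; _↑ʳ_)
open import Data.Fin.Properties using (any?)
open import Data.Fin.Subset using (Subset; Nonempty)
open import Data.Integer.Base as ℤ using (ℤ; +_; -[1+_]; _⊖_)
import Data.Integer.Properties as ℤₚ
open import Data.Maybe.Base using (Maybe; just; nothing)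
open import Data.Nat.Base as ℕ using (ℕ; zero; suc; ⌊_/2⌋)
import Data.Nat.DivMod as ℕ/
import Data.Nat.Properties as ℕₚ
open import Data.Nat.Solver using (module +-*-Solver)
open import Data.Product.Base using (_×_; _,_; proj₁; proj₂; ∃-syntax; Σ-syntax)
open import Data.Sum.Base using (_⊎_; inj₁; inj₂)
open import Data.Vec.Base using (Vec; []; _∷_; head; tail; lookup; replicate)
open import Data.Vec.Functional as Vector using (Vector; _++_; insertAt; foldr)
open import Data.Vec.Functional.Properties using (insertAt-lookup; insertAt-punchIn; lookup-++ˡ; lookup-++ʳ)
open import Data.Vec.Properties using ([]=⇒lookup)
open import Relation.Binary.Bundles using (DecTotalOrder)
open import Relation.Binary.PropositionalEquality.Core as ≡ using (_≡_)
import Relation.Binary.Reasoning.PartialOrder as PartialOrderReasoning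
import Relation.Binary.Reasoning.Setoid as SetoidReasoning
open import Relation.Binary.Structures using (IsDecTotalOrder)
open import Relation.Nullary using (¬_; yes; no; contradiction; ¬?; decidable-stable)

-- Words, balls and separated codes

-- The number of words of length m and Hamming weight less than e.
ballSize : ℕ → ℕ → ℕ
ballSize _       zero    = 0
ballSize zero    (suc e) = 1
ballSize (suc m) (suc e) = ballSize m (suc e) ℕ.+ ballSize m e

module _ where
  open ℕₚ.≤-Reasoning
  open +-*-Solver

  ^-distribʳ-* : ∀ k a b → (a ℕ.* b) ℕ.^ k ≡ a ℕ.^ k ℕ.* b ℕ.^ k
  ^-distribʳ-* zero    a b = ≡.refl
  ^-distribʳ-* (suc k) a b = ≡.trans (≡.cong (a ℕ.* b ℕ.*_) (^-distribʳ-* k a b))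
    (solve 4 (λ a b c d → a :* b :* (c :* d) := a :* c :* (b :* d)) ≡.refl a b (a ℕ.^ k) (b ℕ.^ k))

  -- The terms of degree less than e in the expansion of (1 + 1/3)^m make up at
  -- least ballSize m e / 3^e.
  ballSize-bound : ∀ m e → ballSize m e ℕ.* 3 ℕ.^ m ℕ.≤ 4 ℕ.^ m ℕ.* 3 ℕ.^ e
  ballSize-bound m       zero    = ℕ.z≤n
  ballSize-bound zero    (suc e) = ℕₚ.≤-trans (ℕₚ.m^n>0 3 (suc e)) (ℕₚ.≤-reflexive (≡.sym (ℕₚ.*-identityˡ _)))
  ballSize-bound (suc m) (suc e) = begin
    (a ℕ.+ b) ℕ.* (3 ℕ.* 3 ℕ.^ m)
      ≡⟨ solve 3 (λ a b t → (a :+ b) :* (con 3 :* t) := con 3 :* (a :* t) :+ con 3 :* (b :* t)) ≡.refl a b (3 ℕ.^ m) ⟩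
    3 ℕ.* (a ℕ.* 3 ℕ.^ m) ℕ.+ 3 ℕ.* (b ℕ.* 3 ℕ.^ m)
      ≤⟨ ℕₚ.+-mono-≤ (ℕₚ.*-monoʳ-≤ 3 (ballSize-bound m (suc e))) (ℕₚ.*-monoʳ-≤ 3 (ballSize-bound m e)) ⟩
    3 ℕ.* (4 ℕ.^ m ℕ.* (3 ℕ.* 3 ℕ.^ e)) ℕ.+ 3 ℕ.* (4 ℕ.^ m ℕ.* 3 ℕ.^ e)
      ≡⟨ solve 2 (λ f t → con 3 :* (f :* (con 3 :* t)) :+ con 3 :* (f :* t) := con 4 :* f :* (con 3 :* t)) ≡.refl (4 ℕ.^ m) (3 ℕ.^ e) ⟩
    4 ℕ.^ suc m ℕ.* 3 ℕ.^ suc e ∎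
    where
    a = ballSize m (suc e)
    b = ballSize m e

  power-< : ∀ a b c N e {m} .{{_ : ℕ.NonZero b}} → a ℕ.≤ b → a ℕ.^ N ℕ.* c ℕ.< b ℕ.^ N →
            suc e ℕ.* N ℕ.≤ m → a ℕ.^ m ℕ.* c ℕ.^ suc e ℕ.< b ℕ.^ m
  power-< a b c N e a≤b aᴺc<bᴺ eN≤m with ℕₚ.m≤n⇒∃[o]m+o≡n eN≤m
  ... | k , ≡.refl = begin-strict
    a ℕ.^ (suc e ℕ.* N ℕ.+ k) ℕ.* c ℕ.^ suc e
      ≡⟨ ≡.cong (ℕ._* c ℕ.^ suc e) (power a) ⟩
    (a ℕ.^ N) ℕ.^ suc e ℕ.* a ℕ.^ k ℕ.* c ℕ.^ suc e
      ≡⟨ solve 3 (λ x y z → x :* y :* z := (x :* z) :* y) ≡.refl ((a ℕ.^ N) ℕ.^ suc e) (a ℕ.^ k) (c ℕ.^ suc e) ⟩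
    (a ℕ.^ N) ℕ.^ suc e ℕ.* c ℕ.^ suc e ℕ.* a ℕ.^ k
      ≡⟨ ≡.cong (ℕ._* a ℕ.^ k) (^-distribʳ-* (suc e) (a ℕ.^ N) c) ⟨
    (a ℕ.^ N ℕ.* c) ℕ.^ suc e ℕ.* a ℕ.^ k
      ≤⟨ ℕₚ.*-monoʳ-≤ ((a ℕ.^ N ℕ.* c) ℕ.^ suc e) (ℕₚ.^-monoˡ-≤ k a≤b) ⟩
    (a ℕ.^ N ℕ.* c) ℕ.^ suc e ℕ.* b ℕ.^ k
      <⟨ ℕₚ.*-monoˡ-< (b ℕ.^ k) {{ℕₚ.m^n≢0 b k}} (ℕₚ.^-monoˡ-< (suc e) aᴺc<bᴺ) ⟩
    (b ℕ.^ N) ℕ.^ suc e ℕ.* b ℕ.^ k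
      ≡⟨ power b ⟨
    b ℕ.^ (suc e ℕ.* N ℕ.+ k) ∎
    where
    power : ∀ b → b ℕ.^ (suc e ℕ.* N ℕ.+ k) ≡ (b ℕ.^ N) ℕ.^ suc e ℕ.* b ℕ.^ k
    power b = ≡.trans (ℕₚ.^-distribˡ-+-* b (suc e ℕ.* N) k)
      (≡.cong (ℕ._* b ℕ.^ k) (≡.trans (≡.cong (b ℕ.^_) (ℕₚ.*-comm (suc e) N)) (≡.sym (ℕₚ.^-*-assoc b N (suc e)))))

  -- It makes 8^m 9^e less than 9^m for m at least 20 e and positive e.
  8²⁰9<9²⁰ : 8 ℕ.^ 20 ℕ.* 9 ℕ.< 9 ℕ.^ 20
  8²⁰9<9²⁰ = ℕₚ.<ᵇ⇒< (8 ℕ.^ 20 ℕ.* 9) (9 ℕ.^ 20) _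

  ballSize²<2^m : ∀ {m e} → e ℕ.* 20 ℕ.≤ m → ballSize m e ℕ.* ballSize m e ℕ.< 2 ℕ.^ m
  ballSize²<2^m {m} {zero}  _     = ℕₚ.m^n>0 2 m
  ballSize²<2^m {m} {suc e} 20e≤m = ℕₚ.*-cancelʳ-< (9 ℕ.^ m) (v ℕ.* v) (2 ℕ.^ m) (begin-strict
    v ℕ.* v ℕ.* 9 ℕ.^ m                             ≡⟨ ≡.cong (v ℕ.* v ℕ.*_) (^-distribʳ-* m 3 3) ⟩
    v ℕ.* v ℕ.* (3 ℕ.^ m ℕ.* 3 ℕ.^ m)               ≡⟨ solve 2 (λ v t → v :* v :* (t :* t) := v :* t :* (v :* t)) ≡.refl v (3 ℕ.^ m) ⟩
    (v ℕ.* 3 ℕ.^ m) ℕ.* (v ℕ.* 3 ℕ.^ m)             ≤⟨ ℕₚ.*-mono-≤ (ballSize-bound m (suc e)) (ballSize-bound m (suc e)) ⟩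
    (4 ℕ.^ m ℕ.* t) ℕ.* (4 ℕ.^ m ℕ.* t)             ≡⟨ solve 2 (λ f t → f :* t :* (f :* t) := f :* f :* (t :* t)) ≡.refl (4 ℕ.^ m) t ⟩
    (4 ℕ.^ m ℕ.* 4 ℕ.^ m) ℕ.* (t ℕ.* t)             ≡⟨ ≡.cong₂ ℕ._*_ (≡.sym (^-distribʳ-* m 4 4)) (≡.sym (^-distribʳ-* (suc e) 3 3)) ⟩
    16 ℕ.^ m ℕ.* 9 ℕ.^ suc e                        ≡⟨ ≡.cong (ℕ._* 9 ℕ.^ suc e) (^-distribʳ-* m 2 8) ⟩
    2 ℕ.^ m ℕ.* 8 ℕ.^ m ℕ.* 9 ℕ.^ suc e             ≡⟨ ℕₚ.*-assoc (2 ℕ.^ m) (8 ℕ.^ m) (9 ℕ.^ suc e) ⟩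
    2 ℕ.^ m ℕ.* (8 ℕ.^ m ℕ.* 9 ℕ.^ suc e)           <⟨ ℕₚ.*-monoʳ-< (2 ℕ.^ m) {{ℕₚ.m^n≢0 2 m}} (power-< 8 9 9 20 e (ℕₚ.n≤1+n 8) 8²⁰9<9²⁰ 20e≤m) ⟩
    2 ℕ.^ m ℕ.* 9 ℕ.^ m                             ∎)
    where
    v = ballSize m (suc e)
    t = 3 ℕ.^ suc e

hamming : ∀ {m} → Vec Bool m → Vec Bool m → ℕ
hamming []      []      = 0
hamming (a ∷ x) (b ∷ y) = if a xor b then suc (hamming x y) else hamming x y

hamming-sym : ∀ {m} (x y : Vec Bool m) → hamming x y ≡ hamming y x
hamming-sym []          []          = ≡.refl
hamming-sym (false ∷ x) (false ∷ y) = hamming-sym x y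
hamming-sym (false ∷ x) (true  ∷ y) = ≡.cong suc (hamming-sym x y)
hamming-sym (true  ∷ x) (false ∷ y) = ≡.cong suc (hamming-sym x y)
hamming-sym (true  ∷ x) (true  ∷ y) = hamming-sym x y

-- The indicator function of the ball of all words at distance less than e from x.
inBall : ∀ {m} → ℕ → Vec Bool m → Vec Bool m → ℕ
inBall zero    _       _       = 0
inBall (suc e) []      []      = 1
inBall (suc e) (a ∷ x) (b ∷ y) = if a xor b then inBall e x y else inBall (suc e) x y

inBall≡0⇒far : ∀ {m} e (x y : Vec Bool m) → inBall e x y ≡ 0 → e ℕ.≤ hamming x y
inBall≡0⇒far zero    _           _           _  = ℕ.z≤n
inBall≡0⇒far (suc e) []          []          ()
inBall≡0⇒far (suc e) (false ∷ x) (false ∷ y) eq = inBall≡0⇒far (suc e) x y eq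
inBall≡0⇒far (suc e) (false ∷ x) (true  ∷ y) eq = ℕ.s≤s (inBall≡0⇒far e x y eq)
inBall≡0⇒far (suc e) (true  ∷ x) (false ∷ y) eq = ℕ.s≤s (inBall≡0⇒far e x y eq)
inBall≡0⇒far (suc e) (true  ∷ x) (true  ∷ y) eq = inBall≡0⇒far (suc e) x y eq

-- The sum of a function over all words of length m.
total : ∀ m → (Vec Bool m → ℕ) → ℕ
total zero    f = f []
total (suc m) f = total m (λ x → f (false ∷ x)) ℕ.+ total m (λ x → f (true ∷ x))

total-0 : ∀ m → total m (λ _ → 0) ≡ 0
total-0 zero    = ≡.refl
total-0 (suc m) = ≡.cong₂ ℕ._+_ (total-0 m) (total-0 m)

total-+ : ∀ m (f g : Vec Bool m → ℕ) → total m (λ x → f x ℕ.+ g x) ≡ total m f ℕ.+ total m g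
total-+ zero    f g = ≡.refl
total-+ (suc m) f g = ≡.trans
  (≡.cong₂ ℕ._+_ (total-+ m (λ x → f (false ∷ x)) (λ x → g (false ∷ x)))
                 (total-+ m (λ x → f (true ∷ x)) (λ x → g (true ∷ x))))
  (solve 4 (λ a b c d → a :+ b :+ (c :+ d) := a :+ c :+ (b :+ d)) ≡.refl
    (total m (λ x → f (false ∷ x))) (total m (λ x → g (false ∷ x)))
    (total m (λ x → f (true ∷ x))) (total m (λ x → g (true ∷ x))))
  where open +-*-Solver

total-inBall : ∀ {m} e (x : Vec Bool m) → total m (inBall e x) ≡ ballSize m e
total-inBall {m}     zero    x           = total-0 m
total-inBall {zero}  (suc e) []          = ≡.refl
total-inBall {suc m} (suc e) (false ∷ x) = ≡.cong₂ ℕ._+_ (total-inBall (suc e) x) (total-inBall e x)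
total-inBall {suc m} (suc e) (true  ∷ x) = ≡.trans
  (≡.cong₂ ℕ._+_ (total-inBall e x) (total-inBall (suc e) x))
  (ℕₚ.+-comm (ballSize m e) (ballSize m (suc e)))

-- A function whose mean is less than 1 has a zero.
total<2^m⇒zero : ∀ m (f : Vec Bool m → ℕ) → total m f ℕ.< 2 ℕ.^ m → ∃[ x ] f x ≡ 0
total<2^m⇒zero zero    f f<1 = [] , ℕₚ.n<1⇒n≡0 f<1
total<2^m⇒zero (suc m) f f<2^m with total m (λ x → f (false ∷ x)) ℕₚ.<? 2 ℕ.^ m
... | yes p = let x , fx≡0 = total<2^m⇒zero m _ p in false ∷ x , fx≡0
... | no ¬p = let x , fx≡0 = total<2^m⇒zero m _ q in true ∷ x , fx≡0
  where
  q : total m (λ x → f (true ∷ x)) ℕ.< 2 ℕ.^ m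
  q = ℕₚ.+-cancelˡ-< (2 ℕ.^ m) _ _ (ℕₚ.≤-<-trans (ℕₚ.+-monoˡ-≤ _ (ℕₚ.≮⇒≥ ¬p))
        (ℕₚ.<-≤-trans f<2^m (ℕₚ.≤-reflexive (≡.cong (2 ℕ.^ m ℕ.+_) (ℕₚ.+-identityʳ _)))))

-- The words in the list C are at pairwise Hamming distance at least e.
Separated : ∀ {m N} → ℕ → Vector (Vec Bool m) N → Set
Separated e C = ∀ {i j} → ¬ i ≡ j → e ℕ.≤ hamming (C i) (C j)

-- The number of codewords at distance less than e from a word.
cover : ∀ {m N} → ℕ → Vector (Vec Bool m) N → Vec Bool m → ℕ
cover {N = zero}  e C y = 0
cover {N = suc N} e C y = inBall e (C zero) y ℕ.+ cover e (λ i → C (suc i)) y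

total-cover : ∀ {m N} e (C : Vector (Vec Bool m) N) → total m (cover e C) ≡ N ℕ.* ballSize m e
total-cover {m} {zero}  e C = total-0 m
total-cover {m} {suc N} e C = ≡.trans (total-+ m (inBall e (C zero)) (cover e (λ i → C (suc i))))
  (≡.cong₂ ℕ._+_ (total-inBall e (C zero)) (total-cover e (λ i → C (suc i))))

cover≡0⇒far : ∀ {m N} e (C : Vector (Vec Bool m) N) y → cover e C y ≡ 0 → ∀ i → e ℕ.≤ hamming (C i) y
cover≡0⇒far e C y eq zero    = inBall≡0⇒far e (C zero) y (ℕₚ.m+n≡0⇒m≡0 _ eq)
cover≡0⇒far e C y eq (suc i) = cover≡0⇒far e (λ i → C (suc i)) y (ℕₚ.m+n≡0⇒n≡0 (inBall e (C zero) y) eq) i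

-- The Gilbert-Varshamov bound: k balls cannot cover a cube of more than k V
-- points, so a word outside of them can be added to k codewords.
separatedCode : ∀ m e k → k ℕ.* ballSize m e ℕ.< 2 ℕ.^ m →
                Σ[ C ∈ Vector (Vec Bool m) (suc k) ] Separated e C
separatedCode m e zero    _      = (λ _ → replicate m false) , λ { {zero} {zero} i≢j → contradiction ≡.refl i≢j }
separatedCode m e (suc k) kV<2^m with separatedCode m e k (ℕₚ.≤-<-trans (ℕₚ.m≤n+m _ (ballSize m e)) kV<2^m)
... | C , separated with total<2^m⇒zero m (cover e C) (≡.subst (ℕ._< 2 ℕ.^ m) (≡.sym (total-cover e C)) kV<2^m)
... | y , uncovered = y Vector.∷ C , λ
  { {zero}  {zero}  i≢j → contradiction ≡.refl i≢j
  ; {zero}  {suc j} _   → ≡.subst (e ℕ.≤_) (hamming-sym (C j) y) (cover≡0⇒far e C y uncovered j)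
  ; {suc i} {zero}  _   → cover≡0⇒far e C y uncovered i
  ; {suc i} {suc j} i≢j → separated (λ i≡j → i≢j (≡.cong suc i≡j)) }

-- Numerical estimates

-- The error 2^q (3/4)^e of q samples in e rounds is at most 1/16: raising q by 1
-- and e by 5 multiplies it by 486/1024, and at q = 0 it holds for 10 rounds.
16*2^q*3^e≤4^e : ∀ q {e} → (q ℕ.+ 2) ℕ.* 5 ℕ.≤ e → 16 ℕ.* (2 ℕ.^ q ℕ.* 3 ℕ.^ e) ℕ.≤ 4 ℕ.^ e
16*2^q*3^e≤4^e q e≥ = go (ℕₚ.≤⇒≤′ e≥)
  where
  open ℕₚ.≤-Reasoning
  open +-*-Solver
  base : ∀ q → 16 ℕ.* (2 ℕ.^ q ℕ.* 3 ℕ.^ ((q ℕ.+ 2) ℕ.* 5)) ℕ.≤ 4 ℕ.^ ((q ℕ.+ 2) ℕ.* 5)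
  base zero    = ℕₚ.≤ᵇ⇒≤ (16 ℕ.* (1 ℕ.* 3 ℕ.^ 10)) (4 ℕ.^ 10) _
  base (suc q) = begin
    16 ℕ.* (2 ℕ.* 2 ℕ.^ q ℕ.* 3 ℕ.^ (5 ℕ.+ e))
      ≡⟨ ≡.cong (λ t → 16 ℕ.* (2 ℕ.* 2 ℕ.^ q ℕ.* t)) (ℕₚ.^-distribˡ-+-* 3 5 e) ⟩
    16 ℕ.* (2 ℕ.* 2 ℕ.^ q ℕ.* (3 ℕ.^ 5 ℕ.* 3 ℕ.^ e))
      ≡⟨ solve 2 (λ x y → con 16 :* (con 2 :* x :* (con 243 :* y)) := con 486 :* (con 16 :* (x :* y))) ≡.refl (2 ℕ.^ q) (3 ℕ.^ e) ⟩
    486 ℕ.* (16 ℕ.* (2 ℕ.^ q ℕ.* 3 ℕ.^ e))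
      ≤⟨ ℕₚ.*-mono-≤ (ℕₚ.≤ᵇ⇒≤ 486 (4 ℕ.^ 5) _) (base q) ⟩
    4 ℕ.^ 5 ℕ.* 4 ℕ.^ e
      ≡⟨ ℕₚ.^-distribˡ-+-* 4 5 e ⟨
    4 ℕ.^ (5 ℕ.+ e) ∎
    where e = (q ℕ.+ 2) ℕ.* 5
  go : ∀ {e} → (q ℕ.+ 2) ℕ.* 5 ℕ.≤′ e → 16 ℕ.* (2 ℕ.^ q ℕ.* 3 ℕ.^ e) ℕ.≤ 4 ℕ.^ e
  go ℕ.≤′-refl = base q
  go {suc e} (ℕ.≤′-step p) = begin
    16 ℕ.* (2 ℕ.^ q ℕ.* (3 ℕ.* 3 ℕ.^ e))
      ≡⟨ solve 2 (λ x y → con 16 :* (x :* (con 3 :* y)) := con 3 :* (con 16 :* (x :* y))) ≡.refl (2 ℕ.^ q) (3 ℕ.^ e) ⟩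
    3 ℕ.* (16 ℕ.* (2 ℕ.^ q ℕ.* 3 ℕ.^ e))
      ≤⟨ ℕₚ.*-mono-≤ (ℕₚ.n≤1+n 3) (go p) ⟩
    4 ℕ.* 4 ℕ.^ e ∎

≤-foldr-⊔ : ∀ {k} (t : Vector ℕ k) i → t i ℕ.≤ foldr ℕ._⊔_ 0 t
≤-foldr-⊔ {suc k} t zero    = ℕₚ.m≤m⊔n _ _
≤-foldr-⊔ {suc k} t (suc i) = ℕₚ.≤-trans (≤-foldr-⊔ (λ i → t (suc i)) i) (ℕₚ.m≤n⊔m _ _)

n/40*20≤⌊n/2⌋ : ∀ n → n ℕ./ 40 ℕ.* 20 ℕ.≤ ⌊ n /2⌋
n/40*20≤⌊n/2⌋ n = begin
  e ℕ.* 20                          ≡⟨ ℕₚ.n≡⌊n+n/2⌋ (e ℕ.* 20) ⟩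
  ⌊ e ℕ.* 20 ℕ.+ e ℕ.* 20 /2⌋       ≡⟨ ≡.cong ⌊_/2⌋ (ℕₚ.*-distribˡ-+ e 20 20) ⟨
  ⌊ e ℕ.* 40 /2⌋                    ≤⟨ ℕₚ.⌊n/2⌋-mono (ℕ/.m/n*n≤m n 40) ⟩
  ⌊ n /2⌋                           ∎
  where
  open ℕₚ.≤-Reasoning
  e = n ℕ./ 40

-- If q < n/400, then 40 * 5 (q + 2) = 200 q + 400 is at most n/2 + n/2.
few-samples : ∀ {n q} → 800 ℕ.≤ n → q ℕ.* 400 ℕ.< n → (q ℕ.+ 2) ℕ.* 5 ℕ.≤ n ℕ./ 40
few-samples {n} {q} 800≤n 400q<n = begin
  (q ℕ.+ 2) ℕ.* 5                     ≡⟨ ℕ/.m*n/n≡m ((q ℕ.+ 2) ℕ.* 5) 40 ⟨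
  (q ℕ.+ 2) ℕ.* 5 ℕ.* 40 ℕ./ 40       ≤⟨ ℕ/./-monoˡ-≤ 40 (ℕₚ.*-cancelʳ-≤ ((q ℕ.+ 2) ℕ.* 5 ℕ.* 40) n 2 twice) ⟩
  n ℕ./ 40                            ∎
  where
  open ℕₚ.≤-Reasoning
  twice : (q ℕ.+ 2) ℕ.* 5 ℕ.* 40 ℕ.* 2 ℕ.≤ n ℕ.* 2
  twice = begin
    (q ℕ.+ 2) ℕ.* 5 ℕ.* 40 ℕ.* 2   ≡⟨ solve 1 (λ q → (q :+ con 2) :* con 5 :* con 40 :* con 2 := q :* con 400 :+ con 800) ≡.refl q ⟩
    q ℕ.* 400 ℕ.+ 800              ≤⟨ ℕₚ.+-mono-≤ (ℕₚ.<⇒≤ 400q<n) 800≤n ⟩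
    n ℕ.+ n                        ≡⟨ solve 1 (λ n → n :+ n := n :* con 2) ≡.refl n ⟩
    n ℕ.* 2                        ∎
    where open +-*-Solver

-- Ordered fields

module OrderedFieldProperties {a ℓ₁ ℓ₂} (F : OrderedField a ℓ₁ ℓ₂) where

  open OrderedField F hiding (zero)
  open RingProperties ring using (-‿involutive; -‿distribˡ-*; -‿distribʳ-*; -0#≈0#; -‿+-comm)
  open SemiringMult semiring using (×-homo-+; ×1-homo-*)
  open SemiringSum semiring public
    using (sum-cong-≋; sum-remove; ∑-distrib-+; *-distribˡ-sum; *-distribʳ-sum; sum-replicate-zero)
  open IsDecTotalOrder isDecTotalOrder public using () renaming
    ( refl to ≤-refl; reflexive to ≤-reflexive; trans to ≤-trans
    ; antisym to ≤-antisym; total to ≤-total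
    ; ≤-respˡ-≈ to ≤-respˡ; ≤-respʳ-≈ to ≤-respʳ )
  module ≤-Reasoning = PartialOrderReasoning (DecTotalOrder.poset decTotalOrder)
  module ≈-Reasoning = SetoidReasoning setoid

  -- Integers as coefficients for the ring solver

  -- The canonical map from the integers.  The values at 0 and 1 are 0# and 1#
  -- themselves, not sums, so that these constants of the solver denote them.
  ι : ℤ → Carrier
  ι (+ 0)           = 0#
  ι (+ 1)           = 1#
  ι (+ suc (suc n)) = fromℕ (suc (suc n))
  ι -[1+ n ]        = - fromℕ (suc n)

  private
    ι-+ : ∀ n → ι (+ n) ≈ fromℕ n
    ι-+ 0             = refl
    ι-+ 1             = sym (+-identityʳ 1#)
    ι-+ (suc (suc n)) = refl

    ι-neg : ∀ n → ι (ℤ.- (+ n)) ≈ - fromℕ n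
    ι-neg zero    = sym -0#≈0#
    ι-neg (suc n) = refl

    ι-⊖ : ∀ m n → ι (m ⊖ n) ≈ fromℕ m - fromℕ n
    ι-⊖ m zero = trans (ι-+ m) (sym (trans (+-congˡ -0#≈0#) (+-identityʳ _)))
    ι-⊖ zero (suc n) = sym (+-identityˡ _)
    ι-⊖ (suc m) (suc n) = begin
      ι (suc m ⊖ suc n)                      ≡⟨ ≡.cong ι (ℤₚ.[1+m]⊖[1+n]≡m⊖n m n) ⟩
      ι (m ⊖ n)                              ≈⟨ ι-⊖ m n ⟩
      fromℕ m - fromℕ n                      ≈⟨ +-congʳ (+-identityʳ _) ⟨
      fromℕ m + 0# - fromℕ n                 ≈⟨ +-congʳ (+-congˡ (-‿inverseʳ 1#)) ⟨
      fromℕ m + (1# - 1#) - fromℕ n          ≈⟨ +-congʳ (+-assoc _ _ _) ⟨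
      fromℕ m + 1# - 1# - fromℕ n            ≈⟨ +-assoc _ _ _ ⟩
      fromℕ m + 1# + (- 1# - fromℕ n)        ≈⟨ +-cong (+-comm _ _) (-‿+-comm 1# (fromℕ n)) ⟩
      1# + fromℕ m - (1# + fromℕ n)          ∎
      where open ≈-Reasoning

    ι-homo-neg : ∀ i → ι (ℤ.- i) ≈ - ι i
    ι-homo-neg (+ n)    = trans (ι-neg n) (-‿cong (sym (ι-+ n)))
    ι-homo-neg -[1+ n ] = trans (ι-+ (suc n)) (sym (-‿involutive _))

    ι-homo-+ : ∀ i j → ι (i ℤ.+ j) ≈ ι i + ι j
    ι-homo-+ (+ m) (+ n) = trans (ι-+ (m ℕ.+ n))
      (trans (×-homo-+ 1# m n) (sym (+-cong (ι-+ m) (ι-+ n))))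
    ι-homo-+ (+ m) -[1+ n ] = trans (ι-⊖ m (suc n)) (+-congʳ (sym (ι-+ m)))
    ι-homo-+ -[1+ m ] (+ n) = trans (ι-⊖ n (suc m))
      (trans (+-comm _ _) (+-congˡ (sym (ι-+ n))))
    ι-homo-+ -[1+ m ] -[1+ n ] = begin
      - fromℕ (suc (suc (m ℕ.+ n)))          ≡⟨ ≡.cong (λ k → - fromℕ (suc k)) (ℕₚ.+-suc m n) ⟨
      - fromℕ (suc m ℕ.+ suc n)              ≈⟨ -‿cong (×-homo-+ 1# (suc m) (suc n)) ⟩
      - (fromℕ (suc m) + fromℕ (suc n))      ≈⟨ -‿+-comm _ _ ⟨
      - fromℕ (suc m) - fromℕ (suc n)        ∎
      where open ≈-Reasoning

    ι-homo-+* : ∀ m j → ι (+ m ℤ.* j) ≈ fromℕ m * ι j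
    ι-homo-+* m (+ n) = begin
      ι (+ m ℤ.* + n)          ≡⟨ ≡.cong ι (ℤₚ.pos-* m n) ⟨
      ι (+ (m ℕ.* n))          ≈⟨ ι-+ (m ℕ.* n) ⟩
      fromℕ (m ℕ.* n)          ≈⟨ ×1-homo-* m n ⟩
      fromℕ m * fromℕ n        ≈⟨ *-congˡ (ι-+ n) ⟨
      fromℕ m * ι (+ n)        ∎
      where open ≈-Reasoning
    ι-homo-+* m -[1+ n ] = begin
      ι (+ m ℤ.* -[1+ n ])           ≡⟨ ≡.cong ι (ℤₚ.neg-distribʳ-* (+ m) (+ suc n)) ⟨
      ι (ℤ.- (+ m ℤ.* + suc n))      ≈⟨ ι-homo-neg (+ m ℤ.* + suc n) ⟩
      - ι (+ m ℤ.* + suc n)          ≈⟨ -‿cong (ι-homo-+* m (+ suc n)) ⟩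
      - (fromℕ m * ι (+ suc n))      ≈⟨ -‿cong (*-congˡ (ι-+ (suc n))) ⟩
      - (fromℕ m * fromℕ (suc n))    ≈⟨ -‿distribʳ-* _ _ ⟩
      fromℕ m * - fromℕ (suc n)      ∎
      where open ≈-Reasoning

    ι-homo-* : ∀ i j → ι (i ℤ.* j) ≈ ι i * ι j
    ι-homo-* (+ m) j = trans (ι-homo-+* m j) (*-congʳ (sym (ι-+ m)))
    ι-homo-* -[1+ m ] j = begin
      ι (-[1+ m ] ℤ.* j)             ≡⟨ ≡.cong ι (ℤₚ.neg-distribˡ-* (+ suc m) j) ⟨
      ι (ℤ.- (+ suc m ℤ.* j))        ≈⟨ ι-homo-neg (+ suc m ℤ.* j) ⟩
      - ι (+ suc m ℤ.* j)            ≈⟨ -‿cong (ι-homo-+* (suc m) j) ⟩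
      - (fromℕ (suc m) * ι j)        ≈⟨ -‿distribˡ-* _ _ ⟩
      - fromℕ (suc m) * ι j          ∎
      where open ≈-Reasoning

    ℤ-rawRing : RawRing _ _
    ℤ-rawRing = record
      { Carrier = ℤ ; _≈_ = _≡_ ; _+_ = ℤ._+_ ; _*_ = ℤ._*_ ; -_ = ℤ.-_ ; 0# = + 0 ; 1# = + 1 }

    ι-morphism : ℤ-rawRing -Raw-AlmostCommutative⟶ fromCommutativeRing commutativeRing
    ι-morphism = record
      { ⟦_⟧ = ι ; +-homo = ι-homo-+ ; *-homo = ι-homo-* ; -‿homo = ι-homo-neg
      ; 0-homo = refl ; 1-homo = refl }

    ι-≟ : ∀ i j → Maybe (ι i ≈ ι j)
    ι-≟ i j with i ℤₚ.≟ j
    ... | yes i≡j = just (reflexive (≡.cong ι i≡j))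
    ... | no  _   = nothing

  open RingSolver ℤ-rawRing (fromCommutativeRing commutativeRing) ι-morphism ι-≟ public
    using (solve; _:=_; _:+_; _:*_; _:-_; :-_; con)


  -- Order

  ≤-by-diff : ∀ {x y d} → 0# ≤ d → y ≈ x + d → x ≤ y
  ≤-by-diff {x} 0≤d y≈x+d =
    ≤-respˡ (+-identityʳ x) (≤-respʳ (sym y≈x+d) (+-monoʳ-≤ x 0≤d))

  0≤y-x : ∀ {x y} → x ≤ y → 0# ≤ y - x
  0≤y-x {x} {y} x≤y = ≤-respˡ (-‿inverseˡ x) (≤-respʳ (+-comm (- x) y) (+-monoʳ-≤ (- x) x≤y))

  +-mono-≤ : ∀ {x y u v} → x ≤ y → u ≤ v → x + u ≤ y + v
  +-mono-≤ {x} {y} {u} {v} x≤y u≤v = ≤-trans (+-monoʳ-≤ x u≤v)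
    (≤-respˡ (+-comm v x) (≤-respʳ (+-comm v y) (+-monoʳ-≤ v x≤y)))

  +-nonNegative : ∀ {x y} → 0# ≤ x → 0# ≤ y → 0# ≤ x + y
  +-nonNegative 0≤x 0≤y = ≤-respˡ (+-identityʳ 0#) (+-mono-≤ 0≤x 0≤y)

  *-monoˡ-≤ : ∀ {z x y} → 0# ≤ z → x ≤ y → z * x ≤ z * y
  *-monoˡ-≤ {z} {x} {y} 0≤z x≤y = ≤-by-diff (*-nonNegative 0≤z (0≤y-x x≤y))
    (solve 3 (λ z x y → z :* y := z :* x :+ z :* (y :- x)) refl z x y)

  neg-nonNegative : ∀ {x} → x ≤ 0# → 0# ≤ - x
  neg-nonNegative {x} x≤0 = ≤-respʳ (+-identityˡ (- x)) (0≤y-x x≤0)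

  0≤1 : 0# ≤ 1#
  0≤1 with ≤-total 0# 1#
  ... | inj₁ 0≤1 = 0≤1
  ... | inj₂ 1≤0 = ≤-respʳ (solve 0 (:- con (+ 1) :* :- con (+ 1) := con (+ 1)) refl)
                     (*-nonNegative (neg-nonNegative 1≤0) (neg-nonNegative 1≤0))

  fromℕ-homo-* : ∀ m n → fromℕ (m ℕ.* n) ≈ fromℕ m * fromℕ n
  fromℕ-homo-* = ×1-homo-*

  fromℕ-nonNegative : ∀ n → 0# ≤ fromℕ n
  fromℕ-nonNegative zero    = ≤-refl
  fromℕ-nonNegative (suc n) = +-nonNegative 0≤1 (fromℕ-nonNegative n)

  fromℕ-mono-≤ : ∀ {m n} → m ℕ.≤ n → fromℕ m ≤ fromℕ n
  fromℕ-mono-≤ {n = n} ℕ.z≤n = fromℕ-nonNegative n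
  fromℕ-mono-≤ (ℕ.s≤s m≤n) = +-monoʳ-≤ 1# (fromℕ-mono-≤ m≤n)

  <-≤-trans : ∀ {x y z} → x < y → y ≤ z → x < z
  <-≤-trans (x≤y , x≉y) y≤z = ≤-trans x≤y y≤z ,
    λ x≈z → x≉y (≤-antisym x≤y (≤-respʳ (sym x≈z) y≤z))

  0<1 : 0# < 1#
  0<1 = 0≤1 , λ 0≈1 → 1≉0 (sym 0≈1)

  0<fromℕ : ∀ n → 0# < fromℕ (suc n)
  0<fromℕ n = <-≤-trans 0<1 (≤-by-diff (fromℕ-nonNegative n) refl)

  >⇒≉ : ∀ {x} → 0# < x → x ≉ 0#
  >⇒≉ (_ , 0≉x) x≈0 = 0≉x (sym x≈0)

  ≤∨> : ∀ x y → x ≤ y ⊎ y < x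
  ≤∨> x y with x ≤? y | ≤-total x y
  ... | yes x≤y | _        = inj₁ x≤y
  ... | no  x≰y | inj₁ x≤y = contradiction x≤y x≰y
  ... | no  x≰y | inj₂ y≤x = inj₂ (y≤x , λ y≈x → x≰y (≤-reflexive (sym y≈x)))

  *≈0⇒≈0 : ∀ {x y} → x ≉ 0# → x * y ≈ 0# → y ≈ 0#
  *≈0⇒≈0 {x} {y} x≉0 xy≈0 = begin
    y                ≈⟨ *-identityˡ y ⟨
    1# * y           ≈⟨ *-congʳ (*-inverseʳ x≉0) ⟨
    x * x ⁻¹ * y     ≈⟨ solve 3 (λ x i y → x :* i :* y := i :* (x :* y)) refl x (x ⁻¹) y ⟩
    x ⁻¹ * (x * y)   ≈⟨ *-congˡ xy≈0 ⟩
    x ⁻¹ * 0#        ≈⟨ zeroʳ _ ⟩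
    0#               ∎
    where open ≈-Reasoning

  *-positive : ∀ {x y} → 0# < x → 0# < y → 0# < x * y
  *-positive 0<x 0<y = *-nonNegative (proj₁ 0<x) (proj₁ 0<y) ,
    λ 0≈xy → >⇒≉ 0<y (*≈0⇒≈0 (>⇒≉ 0<x) (sym 0≈xy))

  ⁻¹-positive : ∀ {x} → 0# < x → 0# < x ⁻¹
  ⁻¹-positive {x} 0<x with ≤∨> (x ⁻¹) 0#
  ... | inj₂ 0<x⁻¹ = 0<x⁻¹
  ... | inj₁ x⁻¹≤0 = contradiction (≤-antisym 1≤0 0≤1) 1≉0
    where
    1≤0 : 1# ≤ 0#
    1≤0 = ≤-by-diff (*-nonNegative (proj₁ 0<x) (neg-nonNegative x⁻¹≤0))
      (trans (sym (-‿inverseʳ 1#)) (trans (+-congˡ (-‿cong (sym (*-inverseʳ (>⇒≉ 0<x))))) (+-congˡ (-‿distribʳ-* _ _))))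

  *-cancelˡ-≤ : ∀ {z x y} → 0# < z → z * x ≤ z * y → x ≤ y
  *-cancelˡ-≤ {z} {x} {y} 0<z zx≤zy =
    ≤-respˡ (cancel x) (≤-respʳ (cancel y) (*-monoˡ-≤ (proj₁ (⁻¹-positive 0<z)) zx≤zy))
    where
    cancel : ∀ w → z ⁻¹ * (z * w) ≈ w
    cancel w = trans (solve 3 (λ z i w → i :* (z :* w) := z :* i :* w) refl z (z ⁻¹) w)
      (trans (*-congʳ (*-inverseʳ (>⇒≉ 0<z))) (*-identityˡ w))

  -- Sums

  sum-mono-≤ : ∀ {n} {t u : Vector Carrier n} → (∀ i → t i ≤ u i) → sum t ≤ sum u
  sum-mono-≤ {zero}  t≤u = ≤-refl
  sum-mono-≤ {suc n} t≤u = +-mono-≤ (t≤u zero) (sum-mono-≤ (λ i → t≤u (suc i)))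

  sum-nonNegative : ∀ {n} {t : Vector Carrier n} → (∀ i → 0# ≤ t i) → 0# ≤ sum t
  sum-nonNegative {n} 0≤t = ≤-respˡ (sum-replicate-zero n) (sum-mono-≤ 0≤t)

  term≤sum : ∀ {n} {t : Vector Carrier n} → (∀ i → 0# ≤ t i) → ∀ i → t i ≤ sum t
  term≤sum {suc n} {t} 0≤t i = ≤-by-diff (sum-nonNegative (λ j → 0≤t (punchIn i j))) (sum-remove {i = i} t)

  sum≈0⇒term≈0 : ∀ {n} {t : Vector Carrier n} → (∀ i → 0# ≤ t i) → sum t ≈ 0# → ∀ i → t i ≈ 0#
  sum≈0⇒term≈0 0≤t sum≈0 i = ≤-antisym (≤-respʳ sum≈0 (term≤sum 0≤t i)) (0≤t i)

  -- Absolute values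

  private
    module Max = MaxProperties (DecTotalOrder.totalOrder decTotalOrder)

  x≤abs : ∀ x → x ≤ abs x
  x≤abs x = Max.x≤x⊔y x (- x)

  -x≤abs : ∀ x → - x ≤ abs x
  -x≤abs x = Max.x≤y⊔x x (- x)

  0≤abs : ∀ x → 0# ≤ abs x
  0≤abs x with ≤-total 0# x
  ... | inj₁ 0≤x = ≤-trans 0≤x (x≤abs x)
  ... | inj₂ x≤0 = ≤-trans (neg-nonNegative x≤0) (-x≤abs x)

module LowerBound {a ℓ₁ ℓ₂} (F : OrderedField a ℓ₁ ℓ₂) where

  open OrderedField F hiding (zero)
  open Testing F
  open OrderedFieldProperties F

  -- Linear dependence

  -- More vectors than coordinates are linearly dependent, by Gaussian elimination.
  dependent : ∀ {k N} → k ℕ.< N → (ψ : Fin N → Vector Carrier k) →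
              Σ[ v ∈ Vector Carrier N ] (∃[ i ] v i ≉ 0#) ×
              (∀ c → sum (λ i → v i * ψ i c) ≈ 0#)
  dependent {zero}  {suc N} _ ψ = (λ _ → 1#) , (zero , 1≉0) , λ ()
  dependent {suc k} {suc N} (ℕ.s≤s k<N) ψ with any? (λ i → ¬? (ψ i zero ≟ 0#))
  ... | no none = v , nonzero , λ { zero → column₀ ; (suc c) → kills c }
    where
    ih = dependent (ℕₚ.m<n⇒m<1+n k<N) (λ i c → ψ i (suc c))
    v = proj₁ ih
    nonzero = proj₁ (proj₂ ih)
    kills = proj₂ (proj₂ ih)
    column₀ : sum (λ i → v i * ψ i zero) ≈ 0#
    column₀ = trans
      (sum-cong-≋ (λ i → trans (*-congˡ (decidable-stable (ψ i zero ≟ 0#) (λ ≉0 → none (i , ≉0)))) (zeroʳ (v i))))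
      (sum-replicate-zero (suc N))
  ... | yes (p , pivot≉0) = v , (punchIn p (proj₁ nonzero) , v≉0) , kills
    where
    -- The multiple of the pivot row that clears the first entry of row j.
    ratio : Vector Carrier N
    ratio j = ψ (punchIn p j) zero * ψ p zero ⁻¹
    reduced : Fin N → Vector Carrier (suc k)
    reduced j c = ψ (punchIn p j) c - ratio j * ψ p c
    ih = dependent k<N (λ j c → reduced j (suc c))
    v′ = proj₁ ih
    nonzero = proj₁ (proj₂ ih)
    s = sum (λ j → v′ j * ratio j)
    v = insertAt v′ p (- s)
    v≉0 : v (punchIn p (proj₁ nonzero)) ≉ 0#
    v≉0 v≈0 = proj₂ nonzero (trans (reflexive (≡.sym (insertAt-punchIn v′ p (- s) (proj₁ nonzero)))) v≈0)
    reduced-kills : ∀ c → sum (λ j → v′ j * reduced j c) ≈ 0#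
    reduced-kills zero = trans
      (sum-cong-≋ (λ j → trans (*-congˡ (cancel (ψ (punchIn p j) zero))) (zeroʳ (v′ j))))
      (sum-replicate-zero N)
      where
      cancel : ∀ x → x - x * ψ p zero ⁻¹ * ψ p zero ≈ 0#
      cancel x = begin
        x - x * ψ p zero ⁻¹ * ψ p zero
          ≈⟨ solve 3 (λ x i z → x :- x :* i :* z := x :* (con (+ 1) :- z :* i)) refl x (ψ p zero ⁻¹) (ψ p zero) ⟩
        x * (1# - ψ p zero * ψ p zero ⁻¹)    ≈⟨ *-congˡ (+-congˡ (-‿cong (*-inverseʳ pivot≉0))) ⟩
        x * (1# - 1#)                        ≈⟨ *-congˡ (-‿inverseʳ 1#) ⟩
        x * 0#                               ≈⟨ zeroʳ x ⟩
        0#                                   ∎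
        where open ≈-Reasoning
    reduced-kills (suc c) = proj₂ (proj₂ ih) c
    kills : ∀ c → sum (λ i → v i * ψ i c) ≈ 0#
    kills c = begin
      sum (λ i → v i * ψ i c)
        ≈⟨ sum-remove {i = p} (λ i → v i * ψ i c) ⟩
      v p * ψ p c + sum (λ j → v (punchIn p j) * ψ (punchIn p j) c)
        ≈⟨ +-cong (*-congʳ (reflexive (insertAt-lookup v′ p (- s))))
             (sum-cong-≋ (λ j → *-congʳ (reflexive (insertAt-punchIn v′ p (- s) j)))) ⟩
      - s * ψ p c + sum (λ j → v′ j * ψ (punchIn p j) c)
        ≈⟨ +-congˡ (sum-cong-≋ (λ j → solve 4 (λ v x r z → v :* x := v :* r :* z :+ v :* (x :- r :* z)) refl
             (v′ j) (ψ (punchIn p j) c) (ratio j) (ψ p c))) ⟩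
      - s * ψ p c + sum (λ j → v′ j * ratio j * ψ p c + v′ j * reduced j c)
        ≈⟨ +-congˡ (∑-distrib-+ (λ j → v′ j * ratio j * ψ p c) (λ j → v′ j * reduced j c)) ⟩
      - s * ψ p c + (sum (λ j → v′ j * ratio j * ψ p c) + sum (λ j → v′ j * reduced j c))
        ≈⟨ +-congˡ (+-cong (sym (*-distribʳ-sum (ψ p c) (λ j → v′ j * ratio j))) (reduced-kills c)) ⟩
      - s * ψ p c + (s * ψ p c + 0#)
        ≈⟨ solve 2 (λ s z → :- s :* z :+ (s :* z :+ con (+ 0)) := con (+ 0)) refl s (ψ p c) ⟩
      0# ∎
      where open ≈-Reasoning

  -- Functions of low degree

  -- `Degree< e g` says that g is a multilinear polynomial of degree less than e
  -- in the bits of its argument: write g (b ∷ x) = g₀ x + b g₁ x, where g₀ has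
  -- degree less than e and g₁ has degree less than e - 1.  Degree less than 0
  -- means that g vanishes.
  data Degree< : ∀ {m} → ℕ → (Vec Bool m → Carrier) → Set (a ⊔ ℓ₁) where
    vanishing : ∀ {m} {g : Vec Bool m → Carrier} → (∀ x → g x ≈ 0#) → Degree< 0 g
    constant  : ∀ {e} {g : Vec Bool 0 → Carrier} → Degree< (suc e) g
    branch    : ∀ {m e} {g : Vec Bool (suc m) → Carrier} →
                Degree< (suc e) (λ x → g (false ∷ x)) →
                Degree< e (λ x → g (true ∷ x) - g (false ∷ x)) →
                Degree< (suc e) g

  Degree<-cong : ∀ {m e} {g h : Vec Bool m → Carrier} → (∀ x → g x ≈ h x) → Degree< e g → Degree< e h
  Degree<-cong g≈h (vanishing g≈0) = vanishing (λ x → trans (sym (g≈h x)) (g≈0 x))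
  Degree<-cong g≈h constant        = constant
  Degree<-cong g≈h (branch d₀ d₁)  = branch
    (Degree<-cong (λ x → g≈h (false ∷ x)) d₀)
    (Degree<-cong (λ x → +-cong (g≈h (true ∷ x)) (-‿cong (g≈h (false ∷ x)))) d₁)

  Degree<-0 : ∀ {m} e {g : Vec Bool m → Carrier} → (∀ x → g x ≈ 0#) → Degree< e g
  Degree<-0         zero    g≈0 = vanishing g≈0
  Degree<-0 {zero}  (suc e) g≈0 = constant
  Degree<-0 {suc m} (suc e) g≈0 = branch
    (Degree<-0 (suc e) (λ x → g≈0 (false ∷ x)))
    (Degree<-0 e (λ x → trans (+-cong (g≈0 (true ∷ x)) (-‿cong (g≈0 (false ∷ x)))) (-‿inverseʳ 0#)))

  Degree<-const : ∀ {m} e k → Degree< {m} (suc e) (λ _ → k)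
  Degree<-const {zero}  e k = constant
  Degree<-const {suc m} e k = branch (Degree<-const e k) (Degree<-0 e (λ _ → -‿inverseʳ k))

  Degree<-suc : ∀ {m e} {g : Vec Bool m → Carrier} → Degree< e g → Degree< (suc e) g
  Degree<-suc (vanishing g≈0) = Degree<-0 1 g≈0
  Degree<-suc constant        = constant
  Degree<-suc (branch d₀ d₁)  = branch (Degree<-suc d₀) (Degree<-suc d₁)

  Degree<-+ : ∀ {m e} {g h : Vec Bool m → Carrier} → Degree< e g → Degree< e h → Degree< e (λ x → g x + h x)
  Degree<-+ (vanishing g≈0) (vanishing h≈0) = vanishing (λ x → trans (+-cong (g≈0 x) (h≈0 x)) (+-identityʳ 0#))
  Degree<-+ constant        _               = constant
  Degree<-+ {g = g} {h} (branch d₀ d₁) (branch d₀′ d₁′) = branch (Degree<-+ d₀ d₀′)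
    (Degree<-cong (λ x → solve 4 (λ a b c d → (a :- b) :+ (c :- d) := (a :+ c) :- (b :+ d)) refl
       (g (true ∷ x)) (g (false ∷ x)) (h (true ∷ x)) (h (false ∷ x)))
      (Degree<-+ d₁ d₁′))

  Degree<-* : ∀ {m e} k {g : Vec Bool m → Carrier} → Degree< e g → Degree< e (λ x → k * g x)
  Degree<-* k (vanishing g≈0) = vanishing (λ x → trans (*-congˡ (g≈0 x)) (zeroʳ k))
  Degree<-* k constant        = constant
  Degree<-* k {g} (branch d₀ d₁) = branch (Degree<-* k d₀)
    (Degree<-cong (λ x → solve 3 (λ k a b → k :* (a :- b) := k :* a :- k :* b) refl k (g (true ∷ x)) (g (false ∷ x)))
      (Degree<-* k d₁))

  Degree<-sum : ∀ {m e N} {g : Fin N → Vec Bool m → Carrier} → (∀ i → Degree< e (g i)) →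
                Degree< e (λ x → sum (λ i → g i x))
  Degree<-sum {e = e} {zero}  d = Degree<-0 e (λ _ → refl)
  Degree<-sum {N = suc N} d = Degree<-+ (d zero) (Degree<-sum (λ i → d (suc i)))

  bit : Bool → Carrier
  bit b = if b then 1# else 0#

  -- The values at x of the squarefree monomials of degree less than e.
  monomials : ∀ m e → Vec Bool m → Vector Carrier (ballSize m e)
  monomials m       zero    x = λ ()
  monomials zero    (suc e) x = λ _ → 1#
  monomials (suc m) (suc e) x = monomials m (suc e) (tail x) ++ (λ c → bit (head x) * monomials m e (tail x) c)

  -- A functional that kills these monomials kills their span.
  annihilate : ∀ {m e N} (v : Vector Carrier N) (C : Vector (Vec Bool m) N) →
               (∀ c → sum (λ i → v i * monomials m e (C i) c) ≈ 0#) →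
               ∀ {g} → Degree< e g → sum (λ i → v i * g (C i)) ≈ 0#
  annihilate {N = N} v C kills (vanishing g≈0) = trans
    (sum-cong-≋ (λ i → trans (*-congˡ (g≈0 (C i))) (zeroʳ (v i)))) (sum-replicate-zero N)
  annihilate v C kills {g} constant = begin
    sum (λ i → v i * g (C i))          ≈⟨ sum-cong-≋ (λ i → *-cong (sym (*-identityʳ (v i))) (reflexive (≡.cong g (nil (C i))))) ⟩
    sum (λ i → v i * 1# * g [])        ≈⟨ *-distribʳ-sum (g []) (λ i → v i * 1#) ⟨
    sum (λ i → v i * 1#) * g []        ≈⟨ *-congʳ (kills zero) ⟩
    0# * g []                          ≈⟨ zeroˡ (g []) ⟩
    0#                                 ∎
    where
    open ≈-Reasoning
    nil : (x : Vec Bool 0) → x ≡ []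
    nil [] = ≡.refl
  annihilate {suc m} {suc e} v C kills {g} (branch d₀ d₁) = begin
    sum (λ i → v i * g (C i))
      ≈⟨ sum-cong-≋ (λ i → trans (*-congˡ (split (C i)))
           (solve 4 (λ v x b y → v :* (x :+ b :* y) := v :* x :+ v :* b :* y) refl (v i) _ _ _)) ⟩
    sum (λ i → v i * g (false ∷ tail (C i)) + v i * bit (head (C i)) * (g (true ∷ tail (C i)) - g (false ∷ tail (C i))))
      ≈⟨ ∑-distrib-+ (λ i → v i * g (false ∷ tail (C i))) _ ⟩
    sum (λ i → v i * g (false ∷ tail (C i))) +
    sum (λ i → v i * bit (head (C i)) * (g (true ∷ tail (C i)) - g (false ∷ tail (C i))))
      ≈⟨ +-cong (annihilate v (λ i → tail (C i)) kills₀ d₀)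
                (annihilate (λ i → v i * bit (head (C i))) (λ i → tail (C i)) kills₁ d₁) ⟩
    0# + 0#
      ≈⟨ +-identityʳ 0# ⟩
    0# ∎
    where
    open ≈-Reasoning
    split : ∀ x → g x ≈ g (false ∷ tail x) + bit (head x) * (g (true ∷ tail x) - g (false ∷ tail x))
    split (false ∷ x) = solve 2 (λ y z → y := y :+ con (+ 0) :* (z :- y)) refl (g (false ∷ x)) (g (true ∷ x))
    split (true  ∷ x) = solve 2 (λ y z → z := y :+ con (+ 1) :* (z :- y)) refl (g (false ∷ x)) (g (true ∷ x))
    low  = λ i → monomials m (suc e) (tail (C i))
    high = λ i c → bit (head (C i)) * monomials m e (tail (C i)) c
    kills₀ : ∀ c → sum (λ i → v i * low i c) ≈ 0#
    kills₀ c = trans (sum-cong-≋ (λ i → *-congˡ (reflexive (≡.sym (lookup-++ˡ (low i) (high i) c)))))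
      (kills (c ↑ˡ ballSize m e))
    kills₁ : ∀ c → sum (λ i → v i * bit (head (C i)) * monomials m e (tail (C i)) c) ≈ 0#
    kills₁ c = trans (sum-cong-≋ (λ i → trans (*-assoc _ _ _) (*-congˡ (reflexive (≡.sym (lookup-++ʳ (low i) (high i) c))))))
      (kills (ballSize m (suc e) ↑ʳ c))

  -- Words as weights

  sum-sub : ∀ {n} (t u : Vector Carrier n) → sum (λ i → t i - u i) ≈ sum t - sum u
  sum-sub {zero}  t u = sym (-‿inverseʳ 0#)
  sum-sub {suc n} t u = trans (+-congˡ (sum-sub (λ i → t (suc i)) (λ i → u (suc i))))
    (solve 4 (λ a b c d → (a :- b) :+ (c :- d) := (a :+ c) :- (b :+ d)) refl (t zero) (u zero) _ _)

  bitWeight : Bool → Carrier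
  bitWeight b = if b then fromℕ 2 else 1#

  -- The weights that a word gives to the elements: consecutive elements form a
  -- pair with weights 1, 2 for the bit false and 2, 1 for the bit true, and an
  -- unpaired last element has weight 1.
  weight : ∀ n → Vec Bool ⌊ n /2⌋ → Vector Carrier n
  weight 1             x       zero          = 1#
  weight (suc (suc n)) (b ∷ x) zero          = bitWeight b
  weight (suc (suc n)) (b ∷ x) (suc zero)    = bitWeight (not b)
  weight (suc (suc n)) (b ∷ x) (suc (suc i)) = weight n x i

  1≤2 : 1# ≤ fromℕ 2
  1≤2 = ≤-by-diff (fromℕ-nonNegative 1) refl

  1≤bitWeight : ∀ b → 1# ≤ bitWeight b
  1≤bitWeight false = ≤-refl
  1≤bitWeight true  = 1≤2

  bitWeight≤2 : ∀ b → bitWeight b ≤ fromℕ 2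
  bitWeight≤2 false = 1≤2
  bitWeight≤2 true  = ≤-refl

  1≤weight : ∀ n x i → 1# ≤ weight n x i
  1≤weight 1             x       zero          = ≤-refl
  1≤weight (suc (suc n)) (b ∷ x) zero          = 1≤bitWeight b
  1≤weight (suc (suc n)) (b ∷ x) (suc zero)    = 1≤bitWeight (not b)
  1≤weight (suc (suc n)) (b ∷ x) (suc (suc i)) = 1≤weight n x i

  weight≤2 : ∀ n x i → weight n x i ≤ fromℕ 2
  weight≤2 1             x       zero          = 1≤2
  weight≤2 (suc (suc n)) (b ∷ x) zero          = bitWeight≤2 b
  weight≤2 (suc (suc n)) (b ∷ x) (suc zero)    = bitWeight≤2 (not b)
  weight≤2 (suc (suc n)) (b ∷ x) (suc (suc i)) = weight≤2 n x i

  0≤weight : ∀ n x i → 0# ≤ weight n x i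
  0≤weight n x i = ≤-trans 0≤1 (1≤weight n x i)

  -- The sum of the weights, which does not depend on the word.
  totalWeight : ℕ → Carrier
  totalWeight 0             = 0#
  totalWeight 1             = 1#
  totalWeight (suc (suc n)) = fromℕ 3 + totalWeight n

  sum-weight : ∀ n x → sum (weight n x) ≈ totalWeight n
  sum-weight 0             x           = refl
  sum-weight 1             x           = +-identityʳ 1#
  sum-weight (suc (suc n)) (false ∷ x) = trans (+-congˡ (+-congˡ (sum-weight n x)))
    (solve 1 (λ t → con (+ 1) :+ (con (+ 2) :+ t) := con (+ 3) :+ t) refl (totalWeight n))
  sum-weight (suc (suc n)) (true  ∷ x) = trans (+-congˡ (+-congˡ (sum-weight n x)))
    (solve 1 (λ t → con (+ 2) :+ (con (+ 1) :+ t) := con (+ 3) :+ t) refl (totalWeight n))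

  totalWeight≤2n : ∀ n → totalWeight n ≤ fromℕ 2 * fromℕ n
  totalWeight≤2n 0 = ≤-reflexive (sym (zeroʳ _))
  totalWeight≤2n 1 = ≤-by-diff 0≤1 (solve 0 (con (+ 2) :* (con (+ 1) :+ con (+ 0)) := con (+ 1) :+ con (+ 1)) refl)
  totalWeight≤2n (suc (suc n)) = ≤-trans (+-monoʳ-≤ (fromℕ 3) (totalWeight≤2n n))
    (≤-by-diff 0≤1 (solve 1 (λ t → con (+ 2) :* (con (+ 1) :+ (con (+ 1) :+ t)) := con (+ 3) :+ con (+ 2) :* t :+ con (+ 1)) refl (fromℕ n)))

  0≤totalWeight : ∀ n → 0# ≤ totalWeight n
  0≤totalWeight 0             = ≤-refl
  0≤totalWeight 1             = 0≤1
  0≤totalWeight (suc (suc n)) = +-nonNegative (fromℕ-nonNegative 3) (0≤totalWeight n)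

  0<totalWeight : ∀ n → 0# < totalWeight (suc n)
  0<totalWeight zero    = 0<1
  0<totalWeight (suc n) = <-≤-trans (0<fromℕ 2) (≤-by-diff (0≤totalWeight n) refl)

  -- A factor that depends on the first bit only raises the degree by at most 1.
  Degree<-select : ∀ {m e} {g : Vec Bool (suc m) → Carrier} (k : Bool → Carrier) → Degree< e g →
                   Degree< (suc e) (λ x → k (head x) * g x)
  Degree<-select k (vanishing g≈0) = Degree<-0 1 (λ x → trans (*-congˡ (g≈0 x)) (zeroʳ _))
  Degree<-select k (branch {g = g} d₀ d₁) = branch (Degree<-* (k false) (Degree<-suc d₀))
    (Degree<-cong
      (λ x → solve 4 (λ s t y z → t :* (z :- y) :+ (t :- s) :* y := t :* z :- s :* y) refl
        (k false) (k true) (g (false ∷ x)) (g (true ∷ x)))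
      (Degree<-+ (Degree<-* (k true) (Degree<-suc d₁)) (Degree<-* (k true - k false) d₀)))

  Degree<-weight : ∀ n i {e} {g : Vec Bool ⌊ n /2⌋ → Carrier} → Degree< e g →
                   Degree< (suc e) (λ x → weight n x i * g x)
  Degree<-weight 1 zero d = Degree<-cong (λ x → sym (*-identityˡ _)) (Degree<-suc d)
  Degree<-weight (suc (suc n)) zero d =
    Degree<-cong (λ { (b ∷ x) → refl }) (Degree<-select bitWeight d)
  Degree<-weight (suc (suc n)) (suc zero) d =
    Degree<-cong (λ { (b ∷ x) → refl }) (Degree<-select (λ b → bitWeight (not b)) d)
  Degree<-weight (suc (suc n)) (suc (suc i)) (vanishing g≈0) =
    Degree<-0 1 (λ x → trans (*-congˡ (g≈0 x)) (zeroʳ _))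
  Degree<-weight (suc (suc n)) (suc (suc i)) (branch {g = g} d₀ d₁) = branch (Degree<-weight n i d₀)
    (Degree<-cong
      (λ x → solve 3 (λ w y z → w :* (z :- y) := w :* z :- w :* y) refl (weight n x i) (g (false ∷ x)) (g (true ∷ x)))
      (Degree<-weight n i d₁))

  -- Rejection sampling

  module _ {n : ℕ} where

    -- The number of elements of A.
    card : Subset n → Carrier
    card A = sum (λ j → if lookup A j then 1# else 0#)

    -- One round of rejection sampling from A accepts j with probability
    -- `rate A j * weight n x j`.
    rate : Subset n → Vector Carrier n
    rate A j = if lookup A j then (fromℕ 2 * card A) ⁻¹ else 0#

    -- The probability that T accepts, within a budget of e, when every sample is
    -- simulated by rejection: a round uses up 1, a run without budget left does
    -- not accept, and even an output needs a positive budget.  The budget bounds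
    -- the degree in x, because a round multiplies by one weight.
    approx : ℕ → Algorithm n → Vec Bool ⌊ n /2⌋ → Carrier
    approx zero    T            x = 0#
    approx (suc e) (output b)   x = if b then 1# else 0#
    approx (suc e) (toss p T)   x = sum (λ r → prob p r * approx (suc e) (T r) x)
    approx (suc e) (sample A T) x = approx e (sample A T) x +
      sum (λ j → rate (proj₁ A) j * (weight n x j * (approx e (T j) x - approx e (sample A T) x)))

    Degree<-approx : ∀ e T → Degree< e (approx e T)
    Degree<-approx zero    T            = vanishing (λ _ → refl)
    Degree<-approx (suc e) (output b)   = Degree<-const e _
    Degree<-approx (suc e) (toss p T)   = Degree<-sum (λ r → Degree<-* (prob p r) (Degree<-approx (suc e) (T r)))
    Degree<-approx (suc e) (sample A T) = Degree<-+ (Degree<-suc (Degree<-approx e (sample A T)))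
      (Degree<-sum (λ j → Degree<-* (rate (proj₁ A) j) (Degree<-weight n j
        (Degree<-cong
          (λ x → solve 2 (λ y z → y :+ :- con (+ 1) :* z := y :- z) refl (approx e (T j) x) (approx e (sample A T) x))
          (Degree<-+ (Degree<-approx e (T j)) (Degree<-* (- 1#) (Degree<-approx e (sample A T))))))))

  -- The bound 2^q (3/4)^e on the probability that q samples do not fit into the
  -- budget e.
  bound : ℕ → ℕ → Carrier
  bound q zero    = fromℕ (2 ℕ.^ q)
  bound q (suc e) = fromℕ 3 * fromℕ 4 ⁻¹ * bound q e

  4*¼≈1 : fromℕ 4 * fromℕ 4 ⁻¹ ≈ 1#
  4*¼≈1 = *-inverseʳ (>⇒≉ (0<fromℕ 3))

  0≤bound : ∀ q e → 0# ≤ bound q e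
  0≤bound q zero    = fromℕ-nonNegative (2 ℕ.^ q)
  0≤bound q (suc e) = *-nonNegative (*-nonNegative (fromℕ-nonNegative 3) (proj₁ (⁻¹-positive (0<fromℕ 3)))) (0≤bound q e)

  bound-suc : ∀ q e → bound (suc q) e ≈ fromℕ 2 * bound q e
  bound-suc q zero    = fromℕ-homo-* 2 (2 ℕ.^ q)
  bound-suc q (suc e) = trans (*-congˡ (bound-suc q e))
    (solve 2 (λ r b → r :* (con (+ 2) :* b) := con (+ 2) :* (r :* b)) refl (fromℕ 3 * fromℕ 4 ⁻¹) (bound q e))

  4^e*bound : ∀ q e → fromℕ (4 ℕ.^ e) * bound q e ≈ fromℕ (2 ℕ.^ q ℕ.* 3 ℕ.^ e)
  4^e*bound q zero    = trans (solve 1 (λ t → (con (+ 1) :+ con (+ 0)) :* t := t) refl (fromℕ (2 ℕ.^ q)))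
    (reflexive (≡.cong fromℕ (≡.sym (ℕₚ.*-identityʳ (2 ℕ.^ q)))))
  4^e*bound q (suc e) = begin
    fromℕ (4 ℕ.* 4 ℕ.^ e) * (fromℕ 3 * fromℕ 4 ⁻¹ * bound q e)
      ≈⟨ *-congʳ (fromℕ-homo-* 4 (4 ℕ.^ e)) ⟩
    fromℕ 4 * fromℕ (4 ℕ.^ e) * (fromℕ 3 * fromℕ 4 ⁻¹ * bound q e)
      ≈⟨ solve 5 (λ f p t i b → f :* p :* (t :* i :* b) := t :* (p :* b) :* (f :* i)) refl
           (fromℕ 4) (fromℕ (4 ℕ.^ e)) (fromℕ 3) (fromℕ 4 ⁻¹) (bound q e) ⟩
    fromℕ 3 * (fromℕ (4 ℕ.^ e) * bound q e) * (fromℕ 4 * fromℕ 4 ⁻¹)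
      ≈⟨ *-cong (*-congˡ (4^e*bound q e)) 4*¼≈1 ⟩
    fromℕ 3 * fromℕ (2 ℕ.^ q ℕ.* 3 ℕ.^ e) * 1#
      ≈⟨ *-identityʳ _ ⟩
    fromℕ 3 * fromℕ (2 ℕ.^ q ℕ.* 3 ℕ.^ e)
      ≈⟨ fromℕ-homo-* 3 (2 ℕ.^ q ℕ.* 3 ℕ.^ e) ⟨
    fromℕ (3 ℕ.* (2 ℕ.^ q ℕ.* 3 ℕ.^ e))
      ≡⟨ ≡.cong fromℕ (ℕsolve (2 ℕ.^ q) (3 ℕ.^ e)) ⟩
    fromℕ (2 ℕ.^ q ℕ.* 3 ℕ.^ suc e) ∎
    where
    open ≈-Reasoning
    ℕsolve : ∀ x y → 3 ℕ.* (x ℕ.* y) ≡ x ℕ.* (3 ℕ.* y)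
    ℕsolve = S.solve 2 (λ x y → S.con 3 S.:* (x S.:* y) S.:= x S.:* (S.con 3 S.:* y)) ≡.refl
      where module S = +-*-Solver

  16*bound≤1 : ∀ q {e} → (q ℕ.+ 2) ℕ.* 5 ℕ.≤ e → fromℕ 16 * bound q e ≤ 1#
  16*bound≤1 q {e} e≥ = *-cancelˡ-≤ 0<4^e (begin
    fromℕ (4 ℕ.^ e) * (fromℕ 16 * bound q e)
      ≈⟨ solve 3 (λ p s b → p :* (s :* b) := s :* (p :* b)) refl (fromℕ (4 ℕ.^ e)) (fromℕ 16) (bound q e) ⟩
    fromℕ 16 * (fromℕ (4 ℕ.^ e) * bound q e)       ≈⟨ *-congˡ (4^e*bound q e) ⟩
    fromℕ 16 * fromℕ (2 ℕ.^ q ℕ.* 3 ℕ.^ e)         ≈⟨ fromℕ-homo-* 16 (2 ℕ.^ q ℕ.* 3 ℕ.^ e) ⟨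
    fromℕ (16 ℕ.* (2 ℕ.^ q ℕ.* 3 ℕ.^ e))           ≤⟨ fromℕ-mono-≤ (16*2^q*3^e≤4^e q e≥) ⟩
    fromℕ (4 ℕ.^ e)                                ≈⟨ *-identityʳ _ ⟨
    fromℕ (4 ℕ.^ e) * 1#                           ∎)
    where
    open ≤-Reasoning
    0<4^e : 0# < fromℕ (4 ℕ.^ e)
    0<4^e = <-≤-trans (0<fromℕ 0) (fromℕ-mono-≤ (ℕₚ.m^n>0 4 e))

  -- The simulation of an algorithm on the distribution of a word

  module Simulation {n} (x : Vec Bool ⌊ n /2⌋) (μ : Distribution n) {s : Carrier} (0<s : 0# < s)
           (μ≈ws : ∀ i → prob μ i ≈ weight n x i * s) where

    w : Vector Carrier n
    w = weight n x

    -- The weights restricted to A, and their sum.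
    restricted : Subset n → Vector Carrier n
    restricted A j = if lookup A j then w j else 0#

    W : Subset n → Carrier
    W A = sum (restricted A)

    mass≈Ws : ∀ A → mass μ A ≈ W A * s
    mass≈Ws A = trans (sum-cong-≋ pointwise) (sym (*-distribʳ-sum s (restricted A)))
      where
      pointwise : ∀ i → (if lookup A i then prob μ i else 0#) ≈ restricted A i * s
      pointwise i with lookup A i
      ... | true  = μ≈ws i
      ... | false = sym (zeroˡ s)

    card≤W : ∀ A → card A ≤ W A
    card≤W A = sum-mono-≤ pointwise
      where
      pointwise : ∀ i → (if lookup A i then 1# else 0#) ≤ restricted A i
      pointwise i with lookup A i
      ... | true  = 1≤weight n x i
      ... | false = ≤-refl

    W≤2card : ∀ A → W A ≤ fromℕ 2 * card A
    W≤2card A = ≤-respʳ (sym (*-distribˡ-sum (fromℕ 2) (λ i → if lookup A i then 1# else 0#))) (sum-mono-≤ pointwise)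
      where
      pointwise : ∀ i → restricted A i ≤ fromℕ 2 * (if lookup A i then 1# else 0#)
      pointwise i with lookup A i
      ... | true  = ≤-respʳ (sym (*-identityʳ _)) (weight≤2 n x i)
      ... | false = ≤-reflexive (sym (zeroʳ _))

    0<card : ∀ {A : Subset n} → Nonempty A → 0# < card A
    0<card {A} (i , i∈A) = <-≤-trans 0<1 (≤-trans 1≤term (term≤sum nonneg i))
      where
      nonneg : ∀ j → 0# ≤ (if lookup A j then 1# else 0#)
      nonneg j with lookup A j
      ... | true  = 0≤1
      ... | false = ≤-refl
      1≤term : 1# ≤ (if lookup A i then 1# else 0#)
      1≤term = ≤-reflexive (reflexive (≡.cong (λ b → if b then 1# else 0#) (≡.sym ([]=⇒lookup i∈A))))

    module _ (Q : ConditioningSet n) where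

      private
        A = proj₁ Q
        A≢∅ = proj₂ Q

      0<W : 0# < W A
      0<W = <-≤-trans (0<card A≢∅) (card≤W A)

      0<mass : 0# < mass μ A
      0<mass = <-≤-trans (*-positive 0<W 0<s) (≤-reflexive (sym (mass≈Ws A)))

      oracle*W : ∀ j → oracle μ A j * W A ≈ restricted A j
      oracle*W j with lookup A j
      ... | false = zeroˡ (W A)
      ... | true with mass μ A ≟ 0#
      ...   | yes mass≈0 = contradiction mass≈0 (>⇒≉ 0<mass)
      ...   | no  mass≉0 = begin
        prob μ j * mass μ A ⁻¹ * W A     ≈⟨ *-congʳ (*-congʳ (μ≈ws j)) ⟩
        w j * s * mass μ A ⁻¹ * W A      ≈⟨ solve 4 (λ w s i W → w :* s :* i :* W := w :* (W :* s :* i)) refl (w j) s (mass μ A ⁻¹) (W A) ⟩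
        w j * (W A * s * mass μ A ⁻¹)    ≈⟨ *-congˡ (*-congʳ (mass≈Ws A)) ⟨
        w j * (mass μ A * mass μ A ⁻¹)   ≈⟨ *-congˡ (*-inverseʳ mass≉0) ⟩
        w j * 1#                         ≈⟨ *-identityʳ (w j) ⟩
        w j                              ∎
        where open ≈-Reasoning

      0≤oracle : ∀ j → 0# ≤ oracle μ A j
      0≤oracle j with lookup A j
      ... | false = ≤-refl
      ... | true with mass μ A ≟ 0#
      ...   | yes mass≈0 = contradiction mass≈0 (>⇒≉ 0<mass)
      ...   | no  mass≉0 = *-nonNegative (nonNegative μ j) (proj₁ (⁻¹-positive 0<mass))

      sum-oracle : sum (oracle μ A) ≈ 1#
      sum-oracle = ≤-antisym (*-cancelˡ-≤ 0<W (≤-reflexive eq)) (*-cancelˡ-≤ 0<W (≤-reflexive (sym eq)))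
        where
        eq : W A * sum (oracle μ A) ≈ W A * 1#
        eq = trans (*-comm _ _) (trans (*-distribʳ-sum (W A) (oracle μ A))
          (trans (sum-cong-≋ oracle*W) (sym (*-identityʳ (W A)))))

      -- The probability that one round accepts j, and the probability that it
      -- accepts at all.
      accept : Vector Carrier n
      accept j = rate A j * w j

      σ : Carrier
      σ = sum accept

      κ : Carrier
      κ = (fromℕ 2 * card A) ⁻¹

      0<2card : 0# < fromℕ 2 * card A
      0<2card = *-positive (0<fromℕ 1) (0<card A≢∅)

      accept≈ : ∀ j → accept j ≈ κ * restricted A j
      accept≈ j with lookup A j
      ... | true  = refl
      ... | false = trans (zeroˡ (w j)) (sym (zeroʳ κ))

      σ≈κW : σ ≈ κ * W A
      σ≈κW = trans (sum-cong-≋ accept≈) (sym (*-distribˡ-sum κ (restricted A)))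

      0≤κ : 0# ≤ κ
      0≤κ = proj₁ (⁻¹-positive 0<2card)

      κ*2card≈1 : κ * (fromℕ 2 * card A) ≈ 1#
      κ*2card≈1 = trans (*-comm _ _) (*-inverseʳ (>⇒≉ 0<2card))

      σ≤1 : σ ≤ 1#
      σ≤1 = ≤-respˡ (sym σ≈κW) (≤-respʳ κ*2card≈1 (*-monoˡ-≤ 0≤κ (W≤2card A)))

      1≤2σ : 1# ≤ fromℕ 2 * σ
      1≤2σ = ≤-respˡ κ*2card≈1 (≤-respʳ (*-congˡ (sym σ≈κW))
        (≤-respˡ (solve 2 (λ k c → con (+ 2) :* (k :* c) := k :* (con (+ 2) :* c)) refl κ (card A))
          (*-monoˡ-≤ (fromℕ-nonNegative 2) (*-monoˡ-≤ 0≤κ (card≤W A)))))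

      0≤accept : ∀ j → 0# ≤ accept j
      0≤accept j = ≤-respʳ (sym (accept≈ j)) (*-nonNegative 0≤κ 0≤restricted)
        where
        0≤restricted : 0# ≤ restricted A j
        0≤restricted with lookup A j
        ... | true  = 0≤weight n x j
        ... | false = ≤-refl

      -- Conditioned on acceptance, the round returns a sample of the oracle.
      oracle*σ : ∀ j → oracle μ A j * σ ≈ accept j
      oracle*σ j = begin
        oracle μ A j * σ           ≈⟨ *-congˡ σ≈κW ⟩
        oracle μ A j * (κ * W A)   ≈⟨ solve 3 (λ o k W → o :* (k :* W) := k :* (o :* W)) refl (oracle μ A j) κ (W A) ⟩
        κ * (oracle μ A j * W A)   ≈⟨ *-congˡ (oracle*W j) ⟩
        κ * restricted A j         ≈⟨ accept≈ j ⟨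
        accept j                   ∎
        where open ≈-Reasoning

    0≤Pr : ∀ T b → 0# ≤ Pr μ T b
    0≤Pr (output true)  true  = 0≤1
    0≤Pr (output true)  false = ≤-refl
    0≤Pr (output false) true  = ≤-refl
    0≤Pr (output false) false = 0≤1
    0≤Pr (toss p T)     b     = sum-nonNegative (λ r → *-nonNegative (nonNegative p r) (0≤Pr (T r) b))
    0≤Pr (sample A T)   b     = sum-nonNegative (λ j → *-nonNegative (0≤oracle A j) (0≤Pr (T j) b))

    private
      average : ∀ {k} (t f g : Vector Carrier k) → sum t ≈ 1# → (∀ i → f i + g i ≈ 1#) →
                sum (λ i → t i * f i) + sum (λ i → t i * g i) ≈ 1#
      average t f g sum≈1 f+g≈1 = begin
        sum (λ i → t i * f i) + sum (λ i → t i * g i)    ≈⟨ ∑-distrib-+ (λ i → t i * f i) (λ i → t i * g i) ⟨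
        sum (λ i → t i * f i + t i * g i)                ≈⟨ sum-cong-≋ (λ i → trans (sym (distribˡ (t i) (f i) (g i)))
                                                              (trans (*-congˡ (f+g≈1 i)) (*-identityʳ (t i)))) ⟩
        sum t                                            ≈⟨ sum≈1 ⟩
        1#                                               ∎
        where open ≈-Reasoning

    Pr-total : ∀ T → Pr μ T true + Pr μ T false ≈ 1#
    Pr-total (output true)  = +-identityʳ 1#
    Pr-total (output false) = +-identityˡ 1#
    Pr-total (toss p T)     = average (prob p) _ _ (sum≈1 p) (λ r → Pr-total (T r))
    Pr-total (sample A T)   = average (oracle μ (proj₁ A)) _ _ (sum-oracle A) (λ j → Pr-total (T j))

    -- The acceptance probability that the truncated simulation loses.
    error : ℕ → Algorithm n → Carrier
    error e T = Pr μ T true - approx e T x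

    error-output : ∀ e b → error (suc e) (output b) ≈ 0#
    error-output e true  = -‿inverseʳ 1#
    error-output e false = -‿inverseʳ 0#

    error-toss : ∀ e {k} (p : Distribution k) T →
                 error (suc e) (toss p T) ≈ sum (λ r → prob p r * error (suc e) (T r))
    error-toss e p T = trans (sym (sum-sub (λ r → prob p r * Pr μ (T r) true) (λ r → prob p r * approx (suc e) (T r) x)))
      (sum-cong-≋ (λ r → solve 3 (λ p y z → p :* y :- p :* z := p :* (y :- z)) refl (prob p r) _ _))

    -- A rejected round spends budget only; an accepted one moves on to T j.
    error-sample : ∀ e A T → error (suc e) (sample A T) ≈
      (1# - σ A) * error e (sample A T) + sum (λ j → accept A j * error e (T j))
    error-sample e A T = begin
      P - (f + sum (λ j → rate (proj₁ A) j * (w j * (fⱼ j - f))))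
        ≈⟨ +-congˡ (-‿cong (+-congˡ step)) ⟩
      P - (f + (Σf - σ A * f))
        ≈⟨ solve 4 (λ P f S s → P :- (f :+ (S :- s :* f)) := (con (+ 1) :- s) :* (P :- f) :+ (s :* P :- S)) refl P f Σf (σ A) ⟩
      (1# - σ A) * (P - f) + (σ A * P - Σf)
        ≈⟨ +-congˡ (+-congʳ σP) ⟩
      (1# - σ A) * (P - f) + (sum (λ j → accept A j * Pr μ (T j) true) - Σf)
        ≈⟨ +-congˡ (sum-sub (λ j → accept A j * Pr μ (T j) true) (λ j → accept A j * fⱼ j)) ⟨
      (1# - σ A) * (P - f) + sum (λ j → accept A j * Pr μ (T j) true - accept A j * fⱼ j)
        ≈⟨ +-congˡ (sum-cong-≋ (λ j → solve 3 (λ p y z → p :* y :- p :* z := p :* (y :- z)) refl (accept A j) _ _)) ⟩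
      (1# - σ A) * (P - f) + sum (λ j → accept A j * error e (T j)) ∎
      where
      open ≈-Reasoning
      P = Pr μ (sample A T) true
      f = approx e (sample A T) x
      fⱼ = λ j → approx e (T j) x
      Σf = sum (λ j → accept A j * fⱼ j)
      step : sum (λ j → rate (proj₁ A) j * (w j * (fⱼ j - f))) ≈ Σf - σ A * f
      step = begin
        sum (λ j → rate (proj₁ A) j * (w j * (fⱼ j - f)))
          ≈⟨ sum-cong-≋ (λ j → solve 4 (λ r w y z → r :* (w :* (y :- z)) := r :* w :* y :- r :* w :* z) refl
               (rate (proj₁ A) j) (w j) (fⱼ j) f) ⟩
        sum (λ j → accept A j * fⱼ j - accept A j * f)
          ≈⟨ sum-sub (λ j → accept A j * fⱼ j) (λ j → accept A j * f) ⟩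
        Σf - sum (λ j → accept A j * f)
          ≈⟨ +-congˡ (-‿cong (sym (*-distribʳ-sum f (accept A)))) ⟩
        Σf - σ A * f ∎
      σP : σ A * P ≈ sum (λ j → accept A j * Pr μ (T j) true)
      σP = trans (*-distribˡ-sum (σ A) (λ j → oracle μ (proj₁ A) j * Pr μ (T j) true))
        (sum-cong-≋ (λ j → trans (solve 3 (λ s o p → s :* (o :* p) := o :* s :* p) refl (σ A) _ _)
          (*-congʳ (oracle*σ A j))))

    error-zero : ∀ T → error 0 T ≈ Pr μ T true
    error-zero T = solve 1 (λ p → p :- con (+ 0) := p) refl (Pr μ T true)

    0≤error : ∀ e T → 0# ≤ error e T
    0≤error zero    T            = ≤-respʳ (sym (error-zero T)) (0≤Pr T true)
    0≤error (suc e) (output b)   = ≤-reflexive (sym (error-output e b))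
    0≤error (suc e) (toss p T)   = ≤-respʳ (sym (error-toss e p T))
      (sum-nonNegative (λ r → *-nonNegative (nonNegative p r) (0≤error (suc e) (T r))))
    0≤error (suc e) (sample A T) = ≤-respʳ (sym (error-sample e A T))
      (+-nonNegative (*-nonNegative (0≤y-x (σ≤1 A)) (0≤error e (sample A T)))
        (sum-nonNegative (λ j → *-nonNegative (0≤accept A j) (0≤error e (T j)))))

    -- With B the bound for q samples and a round that accepts with probability σ,
    -- the step for q + 1 samples is (1 - σ) 2 B + σ B, which is at most 3/2 B.
    error≤bound : ∀ e T {q} → samples T ℕ.≤ q → error e T ≤ bound q e
    error≤bound zero T {q} _ = begin
      error 0 T                           ≈⟨ error-zero T ⟩
      Pr μ T true                         ≤⟨ ≤-by-diff (0≤Pr T false) (sym (Pr-total T)) ⟩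
      1#                                  ≈⟨ +-identityʳ 1# ⟨
      fromℕ 1                             ≤⟨ fromℕ-mono-≤ (ℕₚ.m^n>0 2 q) ⟩
      fromℕ (2 ℕ.^ q)                     ∎
      where open ≤-Reasoning
    error≤bound (suc e) (output b) {q} _ = ≤-respˡ (sym (error-output e b)) (0≤bound q (suc e))
    error≤bound (suc e) (toss p T) {q} samples≤q = begin
      error (suc e) (toss p T)                        ≈⟨ error-toss e p T ⟩
      sum (λ r → prob p r * error (suc e) (T r))      ≤⟨ sum-mono-≤ (λ r → *-monoˡ-≤ (nonNegative p r)
                                                           (error≤bound (suc e) (T r)
                                                             (ℕₚ.≤-trans (≤-foldr-⊔ (λ r → samples (T r)) r) samples≤q))) ⟩
      sum (λ r → prob p r * bound q (suc e))          ≈⟨ *-distribʳ-sum (bound q (suc e)) (prob p) ⟨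
      sum (prob p) * bound q (suc e)                  ≈⟨ *-congʳ (sum≈1 p) ⟩
      1# * bound q (suc e)                            ≈⟨ *-identityˡ _ ⟩
      bound q (suc e)                                 ∎
      where open ≤-Reasoning
    error≤bound (suc e) (sample A T) {suc q} (ℕ.s≤s samples≤q) = begin
      error (suc e) (sample A T)
        ≈⟨ error-sample e A T ⟩
      (1# - σ A) * error e (sample A T) + sum (λ j → accept A j * error e (T j))
        ≤⟨ +-mono-≤ (*-monoˡ-≤ (0≤y-x (σ≤1 A)) (error≤bound e (sample A T) {suc q} (ℕ.s≤s samples≤q)))
             (sum-mono-≤ accepted) ⟩
      (1# - σ A) * bound (suc q) e + sum (λ j → accept A j * B)
        ≈⟨ +-cong (*-congˡ (bound-suc q e)) (sym (*-distribʳ-sum B (accept A))) ⟩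
      (1# - σ A) * (fromℕ 2 * B) + σ A * B
        ≤⟨ *-cancelˡ-≤ (0<fromℕ 1) (≤-by-diff (*-nonNegative (0≤y-x (1≤2σ A)) (0≤bound q e)) arithmetic) ⟩
      fromℕ 3 * fromℕ 4 ⁻¹ * (fromℕ 2 * B)
        ≈⟨ *-congˡ (bound-suc q e) ⟨
      bound (suc q) (suc e) ∎
      where
      open ≤-Reasoning
      B = bound q e
      accepted : ∀ j → accept A j * error e (T j) ≤ accept A j * B
      accepted j with lookup (proj₁ A) j | 0≤accept A j
                    | ≤-foldr-⊔ (λ j → if lookup (proj₁ A) j then samples (T j) else 0) j
      ... | true  | 0≤α | samplesⱼ≤ = *-monoˡ-≤ 0≤α (error≤bound e (T j) (ℕₚ.≤-trans samplesⱼ≤ samples≤q))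
      ... | false | _   | _         = ≤-reflexive (trans (vanish _) (sym (vanish _)))
        where
        vanish : ∀ y → 0# * w j * y ≈ 0#
        vanish y = solve 2 (λ w y → con (+ 0) :* w :* y := con (+ 0)) refl (w j) y
      arithmetic : fromℕ 2 * (fromℕ 3 * fromℕ 4 ⁻¹ * (fromℕ 2 * B)) ≈
                   fromℕ 2 * ((1# - σ A) * (fromℕ 2 * B) + σ A * B) + (fromℕ 2 * σ A - 1#) * B
      arithmetic = trans
        (solve 2 (λ i b → con (+ 2) :* (con (+ 3) :* i :* (con (+ 2) :* b)) := con (+ 3) :* (con (+ 4) :* i) :* b) refl (fromℕ 4 ⁻¹) B)
        (trans (*-congʳ (*-congˡ 4*¼≈1))
          (solve 2 (λ s b → con (+ 3) :* con (+ 1) :* b :=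
             con (+ 2) :* ((con (+ 1) :- s) :* (con (+ 2) :* b) :+ s :* b) :+ (con (+ 2) :* s :- con (+ 1)) :* b) refl (σ A) B))

  -- Distances between distributions of words

  -- Each differing bit contributes s for both elements of its pair.
  hamming-sum : ∀ n (x y : Vec Bool ⌊ n /2⌋) {s} → 0# ≤ s → ∀ {t u : Vector Carrier n} →
                (∀ i → t i ≈ weight n x i * s) → (∀ i → u i ≈ weight n y i * s) →
                fromℕ (hamming x y) * (fromℕ 2 * s) ≤ sum (λ i → abs (t i - u i))
  hamming-sum 0 [] [] {s} _ _ _ = ≤-reflexive (zeroˡ _)
  hamming-sum 1 [] [] {s} _ {t} {u} _ _ = ≤-respˡ (sym (zeroˡ _)) (+-nonNegative (0≤abs _) ≤-refl)
  hamming-sum (suc (suc n)) (b ∷ x) (b′ ∷ y) {s} 0≤s {t} {u} t≈ u≈ =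
    pair b b′ (t≈ zero) (t≈ (suc zero)) (u≈ zero) (u≈ (suc zero))
      (hamming-sum n x y 0≤s (λ i → t≈ (suc (suc i))) (λ i → u≈ (suc (suc i))))
    where
    H = hamming x y
    equal : ∀ {d₀ d₁ r} → fromℕ H * (fromℕ 2 * s) ≤ r → fromℕ H * (fromℕ 2 * s) ≤ abs d₀ + (abs d₁ + r)
    equal {d₀} {d₁} {r} h = ≤-trans h (≤-by-diff (+-nonNegative (0≤abs d₀) (0≤abs d₁))
      (solve 3 (λ a b r → a :+ (b :+ r) := r :+ (a :+ b)) refl (abs d₀) (abs d₁) r))
    distinct : ∀ {d₀ d₁ r} → s ≤ abs d₀ → s ≤ abs d₁ → fromℕ H * (fromℕ 2 * s) ≤ r →
               fromℕ (suc H) * (fromℕ 2 * s) ≤ abs d₀ + (abs d₁ + r)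
    distinct h₀ h₁ h = ≤-respˡ
      (solve 2 (λ h s → s :+ (s :+ h :* (con (+ 2) :* s)) := (con (+ 1) :+ h) :* (con (+ 2) :* s)) refl (fromℕ H) s)
      (+-mono-≤ h₀ (+-mono-≤ h₁ h))
    1-2 : ∀ {p r} → p ≈ 1# * s → r ≈ fromℕ 2 * s → s ≤ abs (p - r)
    1-2 {p} {r} p≈ r≈ = ≤-respˡ (trans (-‿cong (+-cong p≈ (-‿cong r≈)))
      (solve 1 (λ s → :- (con (+ 1) :* s :- con (+ 2) :* s) := s) refl s)) (-x≤abs (p - r))
    2-1 : ∀ {p r} → p ≈ fromℕ 2 * s → r ≈ 1# * s → s ≤ abs (p - r)
    2-1 {p} {r} p≈ r≈ = ≤-respˡ (trans (+-cong p≈ (-‿cong r≈))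
      (solve 1 (λ s → con (+ 2) :* s :- con (+ 1) :* s := s) refl s)) (x≤abs (p - r))
    pair : ∀ b b′ {t₀ t₁ u₀ u₁ r} →
           t₀ ≈ bitWeight b * s → t₁ ≈ bitWeight (not b) * s →
           u₀ ≈ bitWeight b′ * s → u₁ ≈ bitWeight (not b′) * s →
           fromℕ H * (fromℕ 2 * s) ≤ r →
           fromℕ (hamming (b ∷ x) (b′ ∷ y)) * (fromℕ 2 * s) ≤ abs (t₀ - u₀) + (abs (t₁ - u₁) + r)
    pair false false _  _  _  _  h = equal h
    pair false true  t₀ t₁ u₀ u₁ h = distinct (1-2 t₀ u₀) (2-1 t₁ u₁) h
    pair true  false t₀ t₁ u₀ u₁ h = distinct (2-1 t₀ u₀) (1-2 t₁ u₁) h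
    pair true  true  _  _  _  _  h = equal h

  -- The normalized weights (a distribution for positive n).
  density : ∀ n → Vec Bool ⌊ n /2⌋ → Vector Carrier n
  density n x i = weight n x i * totalWeight n ⁻¹

  wordDistribution : ∀ n → Vec Bool ⌊ suc n /2⌋ → Distribution (suc n)
  wordDistribution n x = record
    { prob        = density (suc n) x
    ; nonNegative = λ i → *-nonNegative (0≤weight (suc n) x i) (proj₁ (⁻¹-positive (0<totalWeight n)))
    ; sum≈1       = trans (sym (*-distribʳ-sum (totalWeight (suc n) ⁻¹) (weight (suc n) x)))
                      (trans (*-congʳ (sum-weight (suc n) x)) (*-inverseʳ (>⇒≉ (0<totalWeight n))))
    }

  ε : Carrier
  ε = fromℕ 160 ⁻¹

  0<ε : 0# < ε
  0<ε = ⁻¹-positive (0<fromℕ 159)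

  -- The distance is at least h / S, and S is at most 2 n, hence at most 160 h.
  far : ∀ n (x y : Vec Bool ⌊ suc n /2⌋) {ν : Distribution (suc n)} → (∀ i → prob ν i ≈ density (suc n) y i) →
        suc n ℕ.≤ 80 ℕ.* hamming x y → ε ≤ distance (wordDistribution n x) ν
  far n x y {ν} ν≈ n≤80h = *-cancelˡ-≤ (*-positive (0<fromℕ 159) 0<S) (begin
    k * S * ε
      ≈⟨ solve 3 (λ k S e → k :* S :* e := S :* (k :* e)) refl k S ε ⟩
    S * (k * ε)
      ≈⟨ *-congˡ (*-inverseʳ (>⇒≉ (0<fromℕ 159))) ⟩
    S * 1#
      ≈⟨ *-identityʳ S ⟩
    S
      ≤⟨ totalWeight≤2n (suc n) ⟩
    fromℕ 2 * fromℕ (suc n)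
      ≤⟨ *-monoˡ-≤ (fromℕ-nonNegative 2) (fromℕ-mono-≤ n≤80h) ⟩
    fromℕ 2 * fromℕ (80 ℕ.* h)
      ≈⟨ fromℕ-homo-* 2 (80 ℕ.* h) ⟨
    fromℕ (2 ℕ.* (80 ℕ.* h))
      ≡⟨ ≡.cong fromℕ (≡.sym (ℕₚ.*-assoc 2 80 h)) ⟩
    fromℕ (160 ℕ.* h)
      ≈⟨ fromℕ-homo-* 160 h ⟩
    k * fromℕ h
      ≈⟨ *-identityʳ _ ⟨
    k * fromℕ h * 1#
      ≈⟨ *-congˡ (trans (*-cong (*-inverseʳ (>⇒≉ 0<S)) (*-inverseʳ (>⇒≉ (0<fromℕ 1)))) (*-identityʳ 1#)) ⟨
    k * fromℕ h * ((S * S ⁻¹) * (fromℕ 2 * fromℕ 2 ⁻¹))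
      ≈⟨ solve 6 (λ k h S i t j → k :* h :* ((S :* i) :* (t :* j)) := k :* S :* (j :* (h :* (t :* i)))) refl
           k (fromℕ h) S (S ⁻¹) (fromℕ 2) (fromℕ 2 ⁻¹) ⟩
    k * S * (fromℕ 2 ⁻¹ * (fromℕ h * (fromℕ 2 * S ⁻¹)))
      ≤⟨ *-monoˡ-≤ (proj₁ (*-positive (0<fromℕ 159) 0<S))
           (*-monoˡ-≤ (proj₁ (⁻¹-positive (0<fromℕ 1)))
             (hamming-sum (suc n) x y (proj₁ (⁻¹-positive 0<S)) (λ _ → refl) ν≈)) ⟩
    k * S * distance (wordDistribution n x) ν ∎)
    where
    open ≤-Reasoning
    k = fromℕ 160
    S = totalWeight (suc n)
    0<S = 0<totalWeight n
    h = hamming x y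

  -- The hard property

  -- One word more than there are monomials of degree less than n/40.
  codeLength : ℕ → ℕ
  codeLength n = suc (ballSize ⌊ n /2⌋ (n ℕ./ 40))

  -- A separated code together with a nonzero functional on it that annihilates
  -- all polynomials of degree less than n/40.
  record SignedCode (n : ℕ) : Set (a ⊔ ℓ₁) where
    field
      code       : Vector (Vec Bool ⌊ n /2⌋) (codeLength n)
      separated  : Separated (n ℕ./ 40) code
      v          : Vector Carrier (codeLength n)
      index      : Fin (codeLength n)
      v≉0        : v index ≉ 0#
      orthogonal : ∀ {g} → Degree< (n ℕ./ 40) g → sum (λ i → v i * g (code i)) ≈ 0#

  signedCode : ∀ n → SignedCode n
  signedCode n = record
    { code = code ; separated = proj₂ C ; v = proj₁ dep
    ; index = proj₁ (proj₁ (proj₂ dep)) ; v≉0 = proj₂ (proj₁ (proj₂ dep))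
    ; orthogonal = annihilate (proj₁ dep) code (proj₂ (proj₂ dep)) }
    where
    m = ⌊ n /2⌋
    e = n ℕ./ 40
    C = separatedCode m e (ballSize m e) (ballSize²<2^m {m} {e} (n/40*20≤⌊n/2⌋ n))
    code = proj₁ C
    dep = dependent ℕₚ.≤-refl (λ i → monomials m e (code i))

  -- The distributions of the codewords with positive coefficient.
  property : ∀ n → Property n
  property n = record
    { Holds    = λ μ → Lift a (∃[ i ] 0# < v i × (∀ j → prob μ j ≈ density n (code i) j))
    ; respects = λ { μ≈ν (lift (i , 0<vᵢ , μ≈)) → lift (i , 0<vᵢ , λ j → trans (sym (μ≈ν j)) (μ≈ j)) }
    }
    where open SignedCode (signedCode n)

  -- The contradiction

  private
    ½ = fromℕ 2 ⁻¹
    δ = fromℕ 3 ⁻¹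

    2*½≈1 : fromℕ 2 * ½ ≈ 1#
    2*½≈1 = *-inverseʳ (>⇒≉ (0<fromℕ 1))

    3*δ≈1 : fromℕ 3 * δ ≈ 1#
    3*δ≈1 = *-inverseʳ (>⇒≉ (0<fromℕ 2))

    -- The following comparisons combine their hypotheses, refuted conclusion
    -- included, linearly to 0 <= - k with a positive number k.
    absurd : ∀ {k x} → 0# ≤ x → x + fromℕ (suc k) ≈ 0# → ∀ {p} {P : Set p} → P
    absurd {k} {x} 0≤x x+k≈0 = contradiction
      (≤-antisym (≤-by-diff 0≤x (trans (sym x+k≈0) (+-comm x (fromℕ (suc k))))) (fromℕ-nonNegative (suc k)))
      (>⇒≉ (0<fromℕ k))

  -- A word whose distribution must be accepted: f is at least 2/3 - 1/16.
  accepted⇒>½ : ∀ {P f B} → 1# - δ ≤ P → P - f ≤ B → fromℕ 16 * B ≤ 1# → 0# < f - ½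
  accepted⇒>½ {P} {f} {B} accept error small with ≤∨> (f - ½) 0#
  ... | inj₂ 0<f-½ = 0<f-½
  ... | inj₁ f-½≤0 = absurd {4}
    (+-nonNegative (*-nonNegative (fromℕ-nonNegative 48)
        (+-nonNegative (+-nonNegative (0≤y-x accept) (0≤y-x error)) (0≤y-x f-½≤0)))
      (*-nonNegative (fromℕ-nonNegative 3) (0≤y-x small)))
    (trans
      (solve 5 (λ P f B d h →
        con (+ 48) :* ((P :- (con (+ 1) :- d)) :+ (B :- (P :- f)) :+ (con (+ 0) :- (f :- h)))
          :+ con (+ 3) :* (con (+ 1) :- con (+ 16) :* B) :+ con (+ 5) :=
        con (+ 16) :* (con (+ 3) :* d) :+ con (+ 24) :* (con (+ 2) :* h) :- con (+ 40)) refl P f B δ ½)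
      (trans (+-congʳ (+-cong (*-congˡ 3*δ≈1) (*-congˡ 2*½≈1)))
        (solve 0 (con (+ 16) :* con (+ 1) :+ con (+ 24) :* con (+ 1) :- con (+ 40) := con (+ 0)) refl)))

  -- A word whose distribution must be rejected: f is at most P, hence at most 1/3.
  rejected⇒<½ : ∀ {P Q f} → P + Q ≈ 1# → 1# - δ ≤ Q → 0# ≤ P - f → 0# < - (f - ½)
  rejected⇒<½ {P} {Q} {f} P+Q≈1 reject 0≤P-f with ≤∨> (- (f - ½)) 0#
  ... | inj₂ 0<½-f = 0<½-f
  ... | inj₁ ½-f≤0 = absurd {0}
    (*-nonNegative (fromℕ-nonNegative 6) (+-nonNegative (+-nonNegative (0≤y-x reject) 0≤P-f) (0≤y-x ½-f≤0)))
    (trans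
      (solve 5 (λ P Q f d h →
        con (+ 6) :* ((Q :- (con (+ 1) :- d)) :+ (P :- f) :+ (con (+ 0) :- :- (f :- h))) :+ (con (+ 1) :+ con (+ 0)) :=
        con (+ 6) :* (P :+ Q) :+ con (+ 2) :* (con (+ 3) :* d) :- con (+ 3) :* (con (+ 2) :* h) :- con (+ 5)) refl P Q f δ ½)
      (trans (+-congʳ (+-cong (+-cong (*-congˡ P+Q≈1) (*-congˡ 3*δ≈1)) (-‿cong (*-congˡ 2*½≈1))))
        (solve 0 (con (+ 6) :* con (+ 1) :+ con (+ 2) :* con (+ 1) :- con (+ 3) :* con (+ 1) :- con (+ 5) := con (+ 0)) refl)))

  same-sign : ∀ {v g} → (0# < v → 0# < g) → (v < 0# → 0# < - g) → 0# ≤ v * g × (v * g ≈ 0# → v ≈ 0#)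
  same-sign {v} {g} pos neg with v ≟ 0# | ≤-total 0# v
  ... | yes v≈0 | _ = ≤-reflexive (sym (trans (*-congʳ v≈0) (zeroˡ g))) , λ _ → v≈0
  ... | no  v≉0 | inj₁ 0≤v = *-nonNegative 0≤v (proj₁ 0<g) , λ vg≈0 → *≈0⇒≈0 (>⇒≉ 0<g) (trans (*-comm g v) vg≈0)
    where 0<g = pos (0≤v , λ 0≈v → v≉0 (sym 0≈v))
  ... | no  v≉0 | inj₂ v≤0 =
    ≤-respʳ (solve 2 (λ v g → :- v :* :- g := v :* g) refl v g) (*-nonNegative (neg-nonNegative v≤0) (proj₁ 0<-g)) ,
    λ vg≈0 → *≈0⇒≈0 (>⇒≉ 0<-g) (trans (solve 2 (λ v g → :- g :* v := :- (v :* g)) refl v g)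
      (trans (-‿cong vg≈0) (solve 0 (:- con (+ 0) := con (+ 0)) refl)))
    where 0<-g = neg (v≤0 , v≉0)

  -- The terms of the sum of v g are nonnegative with sum zero, so all of them
  -- vanish, and v vanishes with them.
  no-tester : ∀ n (T : Algorithm n) → IsTester (property n) ε δ T → ¬ (samples T ℕ.+ 2) ℕ.* 5 ℕ.≤ n ℕ./ 40
  no-tester zero T _ 5q+10≤0 = contradiction (ℕₚ.≤-trans (ℕₚ.*-monoˡ-≤ 5 (ℕₚ.m≤n+m 2 (samples T))) 5q+10≤0) λ ()
  no-tester (suc n) T tester 5q+10≤e =
    v≉0 (proj₂ (signs index) (sum≈0⇒term≈0 (λ i → proj₁ (signs i)) (orthogonal degree) index))
    where
    open SignedCode (signedCode (suc n))
    open IsTester tester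
    e = suc n ℕ./ 40
    q = samples T
    0<e : 0 ℕ.< e
    0<e = ℕₚ.≤-trans (ℕ.s≤s ℕ.z≤n) (ℕₚ.≤-trans (ℕₚ.*-monoˡ-≤ 5 (ℕₚ.m≤n+m 2 q)) 5q+10≤e)
    g : Vec Bool ⌊ suc n /2⌋ → Carrier
    g x = approx e T x - ½
    degree : Degree< e g
    degree = Degree<-+ (Degree<-approx e T) (half e 0<e)
      where
      half : ∀ e → 0 ℕ.< e → Degree< {⌊ suc n /2⌋} e (λ _ → - ½)
      half (suc e) _ = Degree<-const e (- ½)
    -- Since e is positive, n < 40 (e + 1) is at most 80 e.
    n≤80h : ∀ {h} → e ℕ.≤ h → suc n ℕ.≤ 80 ℕ.* h
    n≤80h {h} e≤h = begin
      suc n                                 ≡⟨ ℕ/.m≡m%n+[m/n]*n (suc n) 40 ⟩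
      suc n ℕ.% 40 ℕ.+ e ℕ.* 40             ≤⟨ ℕₚ.+-monoˡ-≤ (e ℕ.* 40) (ℕₚ.<⇒≤ (ℕ/.m%n<n (suc n) 40)) ⟩
      1 ℕ.* 40 ℕ.+ e ℕ.* 40                 ≤⟨ ℕₚ.+-monoˡ-≤ (e ℕ.* 40) (ℕₚ.*-monoˡ-≤ 40 0<e) ⟩
      e ℕ.* 40 ℕ.+ e ℕ.* 40                 ≡⟨ ℕₚ.*-distribˡ-+ e 40 40 ⟨
      e ℕ.* 80                              ≤⟨ ℕₚ.*-monoˡ-≤ 80 e≤h ⟩
      h ℕ.* 80                              ≡⟨ ℕₚ.*-comm h 80 ⟩
      80 ℕ.* h                              ∎
      where open ℕₚ.≤-Reasoning
    module S i = Simulation (code i) (wordDistribution n (code i)) (⁻¹-positive (0<totalWeight n)) (λ _ → refl)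
    isFar : ∀ i → v i < 0# → Far ε (wordDistribution n (code i)) (property (suc n))
    isFar i (vᵢ≤0 , _) ν (lift (j , 0<vⱼ , ν≈)) = far n (code i) (code j) {ν} ν≈ (n≤80h (separated i≢j))
      where
      i≢j : ¬ i ≡ j
      i≢j ≡.refl = >⇒≉ 0<vⱼ (≤-antisym vᵢ≤0 (proj₁ 0<vⱼ))
    signs : ∀ i → 0# ≤ v i * g (code i) × (v i * g (code i) ≈ 0# → v i ≈ 0#)
    signs i = same-sign
      (λ 0<vᵢ → accepted⇒>½ (accepts _ (lift (i , 0<vᵢ , λ _ → refl)))
                (S.error≤bound i e T ℕₚ.≤-refl) (16*bound≤1 q 5q+10≤e))
      (λ vᵢ<0 → rejected⇒<½ (S.Pr-total i T) (rejects _ (isFar i vᵢ<0)) (S.0≤error i e T))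

  lower-bound : ∀ n → 800 ℕ.≤ n → (T : Algorithm n) → IsTester (property n) ε δ T →
                fromℕ 400 ⁻¹ * fromℕ n ≤ fromℕ (samples T)
  lower-bound n 800≤n T tester = *-cancelˡ-≤ (0<fromℕ 399) (begin
    fromℕ 400 * (fromℕ 400 ⁻¹ * fromℕ n)   ≈⟨ *-assoc _ _ _ ⟨
    fromℕ 400 * fromℕ 400 ⁻¹ * fromℕ n     ≈⟨ *-congʳ (*-inverseʳ (>⇒≉ (0<fromℕ 399))) ⟩
    1# * fromℕ n                           ≈⟨ *-identityˡ _ ⟩
    fromℕ n                                ≤⟨ fromℕ-mono-≤ (ℕₚ.≮⇒≥ (λ 400q<n → no-tester n T tester
                                                (few-samples {q = samples T} 800≤n 400q<n))) ⟩
    fromℕ (samples T ℕ.* 400)              ≡⟨ ≡.cong fromℕ (ℕₚ.*-comm (samples T) 400) ⟩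
    fromℕ (400 ℕ.* samples T)              ≈⟨ fromℕ-homo-* 400 (samples T) ⟩
    fromℕ 400 * fromℕ (samples T)          ∎)
    where open ≤-Reasoning

theorem8p0p1 : ∀ {ℓ ℓ₁ ℓ₂} (F : OrderedField ℓ ℓ₁ ℓ₂) →
    let open OrderedField F
        open Testing F
        δ = fromℕ 3 ⁻¹
    in
    Σ[ ε ∈ Carrier ] Σ[ c ∈ Carrier ] Σ[ P ∈ (∀ n → Property n) ]
      0# < ε × 0# < c ×
      (∃[ n₀ ] ∀ n → n₀ ℕ.≤ n →
        (∀ (T : Algorithm n) → IsTester (P n) ε δ T →
          c * fromℕ n ≤ fromℕ (samples T))
        ×
        (∀ (T : NonAdaptive n) → IsTester (P n) ε δ (algorithm T) →
          c * fromℕ n ≤ fromℕ (samples (algorithm T))))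
theorem8p0p1 F = ε , fromℕ 400 ⁻¹ , property , 0<ε , ⁻¹-positive (0<fromℕ 399) , 800 ,
  λ n 800≤n → lower-bound n 800≤n , λ T → lower-bound n 800≤n (algorithm T)
  where
  open OrderedField F
  open Testing F
  open OrderedFieldProperties F
  open LowerBound F
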